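{- Every cubic graph admits a $5$-weak bisection. That is, for every cubic graph $G=(V,E)$ there is a partition of $V$ into two disjoint sets $V_1$ and $V_2$ with $|V_1|=|V_2|$ such that, for each $i\in\{1,2\}$, every connected component of the subgraph $G[V_i]$ of $G$ induced by $V_i$ is a tree on at most $3$ vertices.
   Context: Graphs are finite and simple (no loops, no parallel edges), and not assumed to be connected or bridgeless; a graph is cubic if every vertex has degree $3$. A bisection of a cubic graph $G=(V,E)$ is a partition of $V$ into two disjoint subsets $V_1,V_2$ with $|V_1|=|V_2|$. For an integer $k\ge 3$, a $k$-weak bisection of $G$ is a bisection $(V_1,V_2)$ such that every connected component of each of the two subgraphs of $G$ induced by $V_1$ and by $V_2$ is a tree on at most $k-2$ vertices. -}

module Defs where

open import Data.Fin.Base using (Fin)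
open import Data.Fin.Subset
  using (Subset; _∈_; _⊆_; _∩_; _∪_; ⊤; ∣_∣; Empty; Nonempty)
open import Data.List.Base using (List; _∷_; _∷ʳ_; length)
open import Data.List.Relation.Unary.Linked using (Linked)
open import Data.List.Relation.Unary.Unique.Propositional using (Unique)
open import Data.Nat.Base using (ℕ; _≤_; _∸_)
open import Data.Product.Base using (Σ; _×_)
open import Data.Vec.Base using (tabulate)
open import Level using (0ℓ)
open import Relation.Binary.Construct.Closure.ReflexiveTransitive using (Star)
open import Relation.Binary.Core using (Rel)
open import Relation.Binary.Definitions using (Decidable; Irreflexive; Symmetric)
open import Relation.Binary.PropositionalEquality.Core using (_≡_)
open import Relation.Nullary using (¬_; does)

record Graph (n : ℕ) : Set₁ where
  field
    Adj    : Rel (Fin n) 0ℓ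
    adj?   : Decidable Adj
    irrefl : Irreflexive _≡_ Adj
    sym    : Symmetric Adj

  neighbours : Fin n → Subset n
  neighbours v = tabulate (λ w → does (adj? v w))

  degree : Fin n → ℕ
  degree v = ∣ neighbours v ∣

Cubic : ∀ {n} → Graph n → Set
Cubic G = ∀ v → Graph.degree G v ≡ 3

module _ {n : ℕ} (G : Graph n) where
  open Graph G

  -- The adjacency relation of the induced subgraph G[S].  Its vertex set is S,
  -- so vertices outside S must be excluded wherever a definition ranges over
  -- the vertices of G[S].
  InducedAdj : Subset n → Rel (Fin n) 0ℓ
  InducedAdj S u v = u ∈ S × v ∈ S × Adj u v

  -- G[S] is connected; the graph without vertices is not.
  record Connected (S : Subset n) : Set where
    field
      nonempty : Nonempty S
      walk     : ∀ {u v} → u ∈ S → v ∈ S → Star (InducedAdj S) u v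

  -- The cycle v₀ v₁ … vₘ v₀ in G[S] has start v₀ and rest v₁ … vₘ.
  record Cycle (S : Subset n) : Set where
    field
      start    : Fin n
      rest     : List (Fin n)
      long     : 3 ≤ length (start ∷ rest)
      distinct : Unique (start ∷ rest)
      closed   : Linked (InducedAdj S) (start ∷ rest ∷ʳ start)

  record IsTree (S : Subset n) : Set where
    field
      connected : Connected S
      acyclic   : ¬ Cycle S

  -- G[C] is a connected component, i.e. a maximal connected subgraph, of G[S].
  -- A maximal connected subgraph is induced, so its vertex set determines it.
  record IsComponent (S C : Subset n) : Set where
    field
      within    : C ⊆ S
      connected : Connected C
      maximal   : ∀ D → D ⊆ S → Connected D → C ⊆ D → D ⊆ C

  SmallTreeComponents : ℕ → Subset n → Set
  SmallTreeComponents m S = ∀ C → IsComponent S C → IsTree C × ∣ C ∣ ≤ m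

  -- The parts may be empty, which matters only for n = 0.
  record IsBisection (V₁ V₂ : Subset n) : Set where
    field
      disjoint : Empty (V₁ ∩ V₂)
      covering : V₁ ∪ V₂ ≡ ⊤
      balanced : ∣ V₁ ∣ ≡ ∣ V₂ ∣

  -- Meaningful for k ≥ 3, since _∸_ truncates.
  record IsWeakBisection (k : ℕ) (V₁ V₂ : Subset n) : Set where
    field
      bisection : IsBisection V₁ V₂
      small₁    : SmallTreeComponents (k ∸ 2) V₁
      small₂    : SmallTreeComponents (k ∸ 2) V₂

  WeakBisection : ℕ → Set
  WeakBisection k = Σ (Subset n) λ V₁ → Σ (Subset n) λ V₂ → IsWeakBisection k V₁ V₂

{-# OPTIONS --safe #-}
-- Among the balanced two-colourings take one with the fewest monochromatic
-- edges and, subject to that, the fewest bad vertices, where two adjacent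
-- vertices of the same colour form a bad pair if both have at least two
-- neighbours of their own colour.  Write d x for the number of neighbours of x
-- in the colour of x.  Swapping the colours of opposite vertices u and v shows
-- d u + d v + [u ~ v] ≤ 3, and a swap with equality keeps the number of
-- monochromatic edges minimal.  Hence d ≤ 2 everywhere, and without bad pairs
-- every monochromatic component is a path on at most 3 vertices.
--
-- Suppose b, c is a bad pair, say white.  Then black vertices have d ≤ 1, and
-- b may be swapped for free with any black v with d v = 1.  Each such v has two
-- white neighbours of degree at most 1, and a discharging argument, in which
-- the white paths feed these v, compares the numbers of white and of black
-- monochromatic edges, which are equal in a balanced colouring.  The pair b, c
-- feeds nothing, so either some v has two white neighbours that are isolated in
-- their colour, or some single white edge feeds too much; each of these leads
-- to a few swaps after which the colouring contradicts extremality.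
module Submission where

open import Defs
open import Data.Bool.Base using (Bool; true; false; not)
import Data.Bool.Properties as Bool
open import Data.Bool.Properties using (not-involutive)
open import Data.Empty using (⊥; ⊥-elim)
open import Data.Fin.Base using (Fin; zero; suc)
open import Data.Fin.Properties using (_≟_; any?)
open import Data.Fin.Subset using (Subset; ∣_∣; ∁; _∈_; _⊆_; ⁅_⁆; _∪_)
open import Data.Fin.Subset.Properties
  using (anySubset?; p⊂q⇒∣p∣<∣q∣; p⊆q⇒∣p∣≤∣q∣; ∣⁅x⁆∣≡1; x∈⁅x⁆; x∈p∪q⁺; x∈p∩q⁻;
         x∈∁p⇒x∉p; x∈p⇒x∉∁p; p∪∁p≡⊤; ∣∁p∣≡n∸∣p∣)
open import Data.List.Base using ([]; _∷_; map; length)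
open import Data.List.Properties using (length-map; map-∘)
open import Data.List.Relation.Unary.All using (_∷_)
open import Data.List.Relation.Unary.AllPairs using (_∷_)
open import Data.List.Relation.Unary.Linked using (_∷_)
open import Data.Nat.Base using (ℕ; zero; suc; _+_; _*_; _∸_; _≤_; _<_; z≤n; s≤s)
open import Data.Nat.ListAction using () renaming (sum to sumL)
import Data.Nat.Properties as ℕ
open import Data.Nat.Solver using (module +-*-Solver)
open import Data.Product.Base using (∃; _×_; _,_; proj₁; proj₂)
open import Data.Sum.Base using (_⊎_; inj₁; inj₂; [_,_]′)
open import Data.Vec.Base using (lookup; tabulate; _[_]%=_; []; _∷_)
open import Data.Vec.Properties
  using (lookup∘updateAt; lookup∘updateAt′; lookup∘tabulate; lookup⇒[]=; []=⇒lookup)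
open import Function.Base using (_∘_)
open import Relation.Binary.Construct.Closure.ReflexiveTransitive using (Star; ε; _◅_)
open import Relation.Binary.PropositionalEquality
open import Relation.Nullary using (¬_; Dec; yes; no; does; contradiction)
open import Relation.Nullary.Decidable using (_×-dec_; decidable-stable; dec-true)
open import Algebra.Properties.CommutativeMonoid.Sum ℕ.+-0-commutativeMonoid
  using (sum; ∑-comm) renaming (sum-cong-≗ to ∑-cong; ∑-distrib-+ to ∑-+)
open import Algebra.Properties.Semiring.Sum ℕ.+-*-semiring using (*-distribˡ-sum)

open +-*-Solver

-- Finite sums of natural numbers

bit : Bool → ℕ
bit true  = 1
bit false = 0

∑-scale : ∀ {n} k (f : Fin n → ℕ) → k * sum f ≡ sum (λ i → k * f i)
∑-scale = *-distribˡ-sum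

∑-mono-≤ : ∀ {n} {f g : Fin n → ℕ} → (∀ i → f i ≤ g i) → sum f ≤ sum g
∑-mono-≤ {zero}  f≤g = z≤n
∑-mono-≤ {suc n} f≤g = ℕ.+-mono-≤ (f≤g zero) (∑-mono-≤ (f≤g ∘ suc))

∑-mono-< : ∀ {n} {f g : Fin n → ℕ} → (∀ i → f i ≤ g i) → ∀ i → f i < g i → sum f < sum g
∑-mono-< f≤g zero    f<g = ℕ.+-mono-<-≤ f<g (∑-mono-≤ (f≤g ∘ suc))
∑-mono-< f≤g (suc i) f<g = ℕ.+-mono-≤-< (f≤g zero) (∑-mono-< (f≤g ∘ suc) i f<g)

∑-≥ : ∀ {n} (f : Fin n → ℕ) i → f i ≤ sum f
∑-≥ f zero    = ℕ.m≤m+n _ _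
∑-≥ f (suc i) = ℕ.≤-trans (∑-≥ (f ∘ suc) i) (ℕ.m≤n+m _ _)

∑-zero : ∀ {n} {f : Fin n → ℕ} → (∀ i → f i ≡ 0) → sum f ≡ 0
∑-zero {zero}  f≡0 = refl
∑-zero {suc n} f≡0 = cong₂ _+_ (f≡0 zero) (∑-zero (f≡0 ∘ suc))

∑-update : ∀ {n} {f g : Fin n → ℕ} u → (∀ i → i ≢ u → g i ≡ f i) → sum g + f u ≡ sum f + g u
∑-update {f = f} {g} zero eq
  rewrite ∑-cong {_} {g ∘ suc} {f ∘ suc} (λ i → eq (suc i) λ ()) =
  solve 3 (λ a b s → a :+ s :+ b := b :+ s :+ a) refl (g zero) (f zero) (sum (f ∘ suc))
∑-update {f = f} {g} (suc u) eq rewrite eq zero λ () =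
  trans (ℕ.+-assoc (f zero) _ _)
    (trans (cong (f zero +_) (∑-update u λ i i≢u → eq (suc i) λ { refl → i≢u refl }))
           (sym (ℕ.+-assoc (f zero) _ _)))

-- Applied to a row of the adjacency matrix, this turns degree 3 into an explicit list of three
-- neighbours, over which every weighted sum can be evaluated.
∑-select : ∀ {n} (P : Fin n → Bool) →
  ∃ λ xs → length xs ≡ sum (bit ∘ P) ×
           (∀ f → sum (λ i → bit (P i) * f i) ≡ sumL (map f xs))
∑-select {zero}  P = [] , refl , λ f → refl
∑-select {suc n} P with P zero | ∑-select (P ∘ suc)
... | true  | xs , len , eq =
  zero ∷ map suc xs , cong suc (trans (length-map suc xs) len) ,
  λ f → cong₂ _+_ (ℕ.*-identityˡ (f zero))
                  (trans (eq (f ∘ suc)) (cong sumL (map-∘ xs)))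
... | false | xs , len , eq =
  map suc xs , trans (length-map suc xs) len ,
  λ f → trans (eq (f ∘ suc)) (cong sumL (map-∘ xs))

∣∣≡∑ : ∀ {n} (p : Subset n) → ∣ p ∣ ≡ sum (λ i → bit (lookup p i))
∣∣≡∑ []          = refl
∣∣≡∑ (true  ∷ p) = cong suc (∣∣≡∑ p)
∣∣≡∑ (false ∷ p) = ∣∣≡∑ p

-- Induction on the size: the first row and the first column have equal sums and meet in a zero, so
-- removing them takes away an even number. For an adjacency matrix this is the handshake lemma.
∑∑-even : ∀ {n} (g : Fin n → Fin n → ℕ) → (∀ i j → g i j ≡ g j i) → (∀ i → g i i ≡ 0) →
  ∃ λ k → sum (λ i → sum (g i)) ≡ k + k
∑∑-even {zero}  g g-sym g-diag = 0 , refl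
∑∑-even {suc n} g g-sym g-diag
  with k , eq ← ∑∑-even (λ i j → g (suc i) (suc j)) (λ i j → g-sym _ _) (λ i → g-diag _)
  = r + k , (begin
    g zero zero + r + sum (λ i → g (suc i) zero + sum (λ j → g (suc i) (suc j)))
      ≡⟨ cong₂ _+_ (cong (_+ r) (g-diag zero))
                   (∑-+ (λ i → g (suc i) zero) _) ⟩
    r + (sum (λ i → g (suc i) zero) + sum (λ i → sum (λ j → g (suc i) (suc j))))
      ≡⟨ cong₂ (λ a b → r + (a + b)) (∑-cong (λ i → g-sym (suc i) zero)) eq ⟩
    r + (r + (k + k))
      ≡⟨ solve 2 (λ r k → r :+ (r :+ (k :+ k)) := (r :+ k) :+ (r :+ k)) refl r k ⟩
    (r + k) + (r + k) ∎)
  where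
  open ≡-Reasoning
  r = sum (λ j → g zero (suc j))

-- Colours and their indicators

same : Bool → Bool → ℕ
same true  true  = 1
same true  false = 0
same false true  = 0
same false false = 1

same-sym : ∀ s t → same s t ≡ same t s
same-sym true  true  = refl
same-sym true  false = refl
same-sym false true  = refl
same-sym false false = refl

same+opp : ∀ s t → same (not s) t + same s t ≡ 1
same+opp true  true  = refl
same+opp true  false = refl
same+opp false true  = refl
same+opp false false = refl

same-refl : ∀ {s t} → s ≡ t → same t s ≡ 1
same-refl {true}  refl = refl
same-refl {false} refl = refl

same-opp : ∀ {s t} → s ≡ not t → same t s ≡ 0
same-opp {t = true}  refl = refl
same-opp {t = false} refl = refl

same≤1 : ∀ s t → same s t ≤ 1
same≤1 true  true  = s≤s z≤n
same≤1 true  false = z≤n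
same≤1 false true  = z≤n
same≤1 false false = s≤s z≤n

either : ∀ t s → s ≡ t ⊎ s ≡ not t
either true  true  = inj₁ refl
either true  false = inj₂ refl
either false true  = inj₂ refl
either false false = inj₁ refl

not≢ : ∀ {s t} → s ≡ t → s ≢ not t
not≢ {true}  refl ()
not≢ {false} refl ()

bit-not : ∀ s t → s ≡ not t → bit (not t) + bit (not s) ≡ bit t + bit s
bit-not _ true  refl = refl
bit-not _ false refl = refl

bit≡same : ∀ t → bit t ≡ same true t
bit≡same true  = refl
bit≡same false = refl

-- For `x` of colour `s`, the other end `y` of an edge either shares this colour or has the opposite
-- one; the factor `same s x` removes every other `x`.
same-split : ∀ s x y → same s x * same x y + same s x * same (not s) y ≡ same s x
same-split true  true  true  = refl
same-split true  true  false = refl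
same-split true  false y     = refl
same-split false true  y     = refl
same-split false false true  = refl
same-split false false false = refl

-- Minimisation over subsets

argmin : ∀ {n} {P : Subset n → Set} → (∀ p → Dec (P p)) → (f : Subset n → ℕ) →
  ∃ P → ∃ λ p → P p × (∀ q → P q → f p ≤ f q)
argmin {n} {P} P? f (p , Pp) = go (f p) p Pp ℕ.≤-refl
  where
  -- The bound `k` on `f p` drops with every improvement, so the search terminates.
  go : ∀ k p → P p → f p ≤ k → ∃ λ p → P p × (∀ q → P q → f p ≤ f q)
  go k p Pp fp≤k with anySubset? (λ q → P? q ×-dec (f q ℕ.<? f p))
  ... | no none = p , Pp , λ q Pq → ℕ.≮⇒≥ λ fq<fp → none (q , Pq , fq<fp)
  go zero    p Pp fp≤k | yes (q , Pq , fq<fp) = contradiction (ℕ.<-≤-trans fq<fp fp≤k) λ ()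
  go (suc k) p Pp fp≤k | yes (q , Pq , fq<fp) = go k q Pq (ℕ.≤-pred (ℕ.<-≤-trans fq<fp fp≤k))

subset-of-size : ∀ n {k} → k ≤ n → ∃ λ (p : Subset n) → ∣ p ∣ ≡ k
subset-of-size zero    z≤n = [] , refl
subset-of-size (suc n) {zero} z≤n with p , eq ← subset-of-size n z≤n = false ∷ p , eq
subset-of-size (suc n) (s≤s k≤n) with p , eq ← subset-of-size n k≤n = true ∷ p , cong suc eq

lookup-∁ : ∀ {n} (p : Subset n) {x} → x ∈ ∁ p → lookup p x ≡ false
lookup-∁ p {x} x∈∁p with either true (lookup p x)
... | inj₂ px = px
... | inj₁ px = contradiction (lookup⇒∈ px) (x∈∁p⇒x∉p x∈∁p)
  where
  lookup⇒∈ : lookup p x ≡ true → x ∈ p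
  lookup⇒∈ = lookup⇒[]= x p

∣p∪q∣≤∣p∣+∣q∣ : ∀ {n} (p q : Subset n) → ∣ p ∪ q ∣ ≤ ∣ p ∣ + ∣ q ∣
∣p∪q∣≤∣p∣+∣q∣ []          []          = z≤n
∣p∪q∣≤∣p∣+∣q∣ (true ∷ p)  (true ∷ q)  = s≤s (ℕ.≤-trans (∣p∪q∣≤∣p∣+∣q∣ p q) (ℕ.+-monoʳ-≤ ∣ p ∣ (ℕ.n≤1+n ∣ q ∣)))
∣p∪q∣≤∣p∣+∣q∣ (true ∷ p)  (false ∷ q) = s≤s (∣p∪q∣≤∣p∣+∣q∣ p q)
∣p∪q∣≤∣p∣+∣q∣ (false ∷ p) (true ∷ q)  = ℕ.≤-trans (s≤s (∣p∪q∣≤∣p∣+∣q∣ p q)) (ℕ.≤-reflexive (sym (ℕ.+-suc ∣ p ∣ ∣ q ∣)))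
∣p∪q∣≤∣p∣+∣q∣ (false ∷ p) (false ∷ q) = ∣p∪q∣≤∣p∣+∣q∣ p q

-- Neighbourhoods in a cubic graph

module CubicGraph {n : ℕ} (G : Graph n) (cubic : Cubic G) where
  open Graph G renaming (sym to adj-sym)

  A : Fin n → Fin n → ℕ
  A x y = bit (does (adj? x y))

  A-adj : ∀ {x y} → Adj x y → A x y ≡ 1
  A-adj {x} {y} xy with adj? x y
  ... | yes _  = refl
  ... | no ¬xy = contradiction xy ¬xy

  A-nonadj : ∀ {x y} → ¬ Adj x y → A x y ≡ 0
  A-nonadj {x} {y} ¬xy with adj? x y
  ... | yes xy = contradiction xy ¬xy
  ... | no _   = refl

  A-sym : ∀ x y → A x y ≡ A y x
  A-sym x y with adj? x y
  ... | yes xy = sym (A-adj (adj-sym xy))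
  ... | no ¬xy = sym (A-nonadj (¬xy ∘ adj-sym))

  A-irrefl : ∀ x → A x x ≡ 0
  A-irrefl x = A-nonadj (irrefl refl)

  -- The neighbours of x are a, b and c, stated in the form used to evaluate
  -- sums over the neighbourhood; membership and distinctness follow.
  record Nb (x a b c : Fin n) : Set where
    constructor nb
    field
      ∑nb : ∀ (f : Fin n → ℕ) → sum (λ w → A x w * f w) ≡ f a + (f b + f c)
  open Nb public

  neighbourhood : ∀ x → ∃ λ a → ∃ λ b → ∃ λ c → Nb x a b c
  neighbourhood x = three xs (trans len degree≡3) eq
    where
    xs = proj₁ (∑-select (λ w → does (adj? x w)))
    len = proj₁ (proj₂ (∑-select (λ w → does (adj? x w))))
    eq = proj₂ (proj₂ (∑-select (λ w → does (adj? x w))))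
    degree≡3 : sum (A x) ≡ 3
    degree≡3 = trans (sym (trans (∣∣≡∑ (neighbours x))
                 (∑-cong {n} λ i → cong bit (lookup∘tabulate (λ w → does (adj? x w)) i)))) (cubic x)
    three : ∀ xs → length xs ≡ 3 → (∀ f → sum (λ w → A x w * f w) ≡ sumL (map f xs)) →
            ∃ λ a → ∃ λ b → ∃ λ c → Nb x a b c
    three (a ∷ b ∷ c ∷ []) refl eq =
      a , b , c , nb λ f → trans (eq f) (cong (λ z → f a + (f b + z)) (ℕ.+-identityʳ (f c)))

  nb-rotate : ∀ {x a b c} → Nb x a b c → Nb x b c a
  nb-rotate {a = a} {b} {c} N = nb λ f → trans (∑nb N f)
    (solve 3 (λ a b c → a :+ (b :+ c) := b :+ (c :+ a)) refl (f a) (f b) (f c))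

  nb-swap : ∀ {x a b c} → Nb x a b c → Nb x a c b
  nb-swap {a = a} {b} {c} N = nb λ f → trans (∑nb N f) (cong (f a +_) (ℕ.+-comm (f b) (f c)))

  δ : Fin n → Fin n → ℕ
  δ u w = bit (does (w ≟ u))

  δ-refl : ∀ u → δ u u ≡ 1
  δ-refl u with u ≟ u
  ... | yes _  = refl
  ... | no u≢u = contradiction refl u≢u

  δ-≢ : ∀ {u w} → w ≢ u → δ u w ≡ 0
  δ-≢ {u} {w} w≢u with w ≟ u
  ... | yes w≡u = contradiction w≡u w≢u
  ... | no _    = refl

  ∑-δ : ∀ (f : Fin n → ℕ) u → sum (λ w → f w * δ u w) ≡ f u
  ∑-δ f u = begin
    sum (λ w → f w * δ u w)     ≡⟨ ℕ.+-identityʳ _ ⟨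
    sum (λ w → f w * δ u w) + 0 ≡⟨ ∑-update {f = λ _ → 0} u (λ w w≢u →
                                     trans (cong (f w *_) (δ-≢ w≢u)) (ℕ.*-zeroʳ (f w))) ⟩
    sum {n} (λ _ → 0) + f u * δ u u ≡⟨ cong₂ _+_ (∑-zero {n} (λ _ → refl))
                                     (trans (cong (f u *_) (δ-refl u)) (ℕ.*-identityʳ (f u))) ⟩
    f u                         ∎
    where open ≡-Reasoning

  -- Obtained by testing `∑nb` on the indicator of `u`. Membership, coverage and distinctness of the
  -- three neighbours are all read off from this identity.
  nb-count : ∀ {x a b c} → Nb x a b c → ∀ u → A x u ≡ δ u a + (δ u b + δ u c)
  nb-count {x} N u = trans (sym (∑-δ (A x) u)) (∑nb N (δ u))

  A≤1 : ∀ x y → A x y ≤ 1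
  A≤1 x y with adj? x y
  ... | yes _ = s≤s z≤n
  ... | no _  = z≤n

  nb-adj : ∀ {x a b c} → Nb x a b c → Adj x a
  nb-adj {x} {a} {b} {c} N with adj? x a
  ... | yes xa = xa
  ... | no ¬xa = contradiction
    (trans (sym (A-nonadj ¬xa)) (trans (nb-count N a) (cong (λ i → i + (δ a b + δ a c)) (δ-refl a)))) λ ()

  nb-adj₂ : ∀ {x a b c} → Nb x a b c → Adj x b
  nb-adj₂ N = nb-adj (nb-rotate N)

  nb-adj₃ : ∀ {x a b c} → Nb x a b c → Adj x c
  nb-adj₃ N = nb-adj (nb-rotate (nb-rotate N))

  nb-cover : ∀ {x a b c w} → Nb x a b c → Adj x w → w ≡ a ⊎ w ≡ b ⊎ w ≡ c
  nb-cover {x} {a} {b} {c} {w} N xw with a ≟ w | b ≟ w | c ≟ w | nb-count N w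
  ... | yes a≡w | _       | _       | _ = inj₁ (sym a≡w)
  ... | no _    | yes b≡w | _       | _ = inj₂ (inj₁ (sym b≡w))
  ... | no _    | no _    | yes c≡w | _ = inj₂ (inj₂ (sym c≡w))
  ... | no _    | no _    | no _    | e = contradiction (trans (sym (A-adj xw)) e) λ ()

  -- A repeated neighbour would be counted twice, against `A≤1`.
  nb-≢ : ∀ {x a b c} → Nb x a b c → a ≢ b
  nb-≢ {x} {a} {b} {c} N refl = contradiction (ℕ.≤-trans (ℕ.≤-reflexive (sym count)) (A≤1 x a))
    λ { (s≤s ()) }
    where
    count : A x a ≡ suc (suc (δ a c))
    count = trans (nb-count N a) (cong₂ (λ i j → i + (j + δ a c)) (δ-refl a) (δ-refl a))

  nb-irrefl : ∀ {x a b c} → Nb x a b c → x ≢ a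
  nb-irrefl N refl = irrefl refl (nb-adj N)

  -- Monochromatic degrees under flips and swaps

  d : Subset n → Fin n → ℕ
  d p x = sum (λ w → A x w * same (lookup p x) (lookup p w))

  flip : Fin n → Subset n → Subset n
  flip u p = p [ u ]%= not

  swap : Fin n → Fin n → Subset n → Subset n
  swap u v p = flip v (flip u p)

  flip-hit : ∀ u p → lookup (flip u p) u ≡ not (lookup p u)
  flip-hit u p = lookup∘updateAt u p

  flip-miss : ∀ {u x} p → x ≢ u → lookup (flip u p) x ≡ lookup p x
  flip-miss p x≢u = lookup∘updateAt′ _ _ x≢u p

  ∑A≡3 : ∀ x → sum (A x) ≡ 3
  ∑A≡3 x with _ , _ , _ , N ← neighbourhood x =
    trans (∑-cong λ w → sym (ℕ.*-identityʳ (A x w))) (∑nb N (λ _ → 1))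

  -- Flipping u exchanges its monochromatic and bichromatic edges.
  d-flip : ∀ p u → d (flip u p) u + d p u ≡ 3
  d-flip p u = trans (sym (∑-+ {n} _ _)) (trans (∑-cong pointwise) (∑A≡3 u))
    where
    pointwise : ∀ w → A u w * same (lookup (flip u p) u) (lookup (flip u p) w) +
                      A u w * same (lookup p u) (lookup p w) ≡ A u w
    pointwise w with w ≟ u
    ... | yes refl rewrite A-irrefl u = refl
    ... | no w≢u rewrite flip-hit u p | flip-miss p w≢u =
      trans (sym (ℕ.*-distribˡ-+ (A u w) (same (not (lookup p u)) (lookup p w)) _))
        (trans (cong (A u w *_) (same+opp (lookup p u) (lookup p w))) (ℕ.*-identityʳ (A u w)))

  -- Only the term of `u` in the degree of `v` changes; its old and new values stand on opposite
  -- sides to avoid subtraction.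
  d-flip-other : ∀ p {u v} → v ≢ u →
    d (flip u p) v + A v u * same (lookup p v) (lookup p u) ≡
    d p v + A v u * same (lookup p v) (not (lookup p u))
  d-flip-other p {u} {v} v≢u = trans
    (∑-update {g = λ w → A v w * same (lookup (flip u p) v) (lookup (flip u p) w)} u
      λ w w≢u → cong (A v w *_) (cong₂ same (flip-miss p v≢u) (flip-miss p w≢u)))
    (cong (λ s → d p v + A v u * s) (cong₂ same (flip-miss p v≢u) (flip-hit u p)))

  -- Every monochromatic edge counts twice.
  E : Subset n → ℕ
  E p = sum (d p)

  -- The flip replaces the `d p u` monochromatic edges at `u` by the other `3 - d p u`. As `E`
  -- counts edges twice, it changes by `6 - 4 * d p u`.
  E-flip : ∀ p u → E (flip u p) + 4 * d p u ≡ E p + 6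
  E-flip p u = begin
    E′ + 4 * d p u           ≡⟨ solve 2 (λ e d → e :+ con 4 :* d := e :+ d :+ d :+ (con 2 :* d)) refl E′ (d p u) ⟩
    E′ + d p u + d p u + 2 * d p u ≡⟨ cong (_+ 2 * d p u) update ⟩
    E p + d′ + d′ + 2 * d p u ≡⟨ solve 3 (λ e d d′ → e :+ d′ :+ d′ :+ con 2 :* d := e :+ con 2 :* (d′ :+ d)) refl (E p) (d p u) d′ ⟩
    E p + 2 * (d′ + d p u)   ≡⟨ cong (λ k → E p + 2 * k) (d-flip p u) ⟩
    E p + 6                  ∎
    where
    open ≡-Reasoning
    E′ = E (flip u p)
    d′ = d (flip u p) u
    -- These are the two sides of `d-flip-other`, which agree for every `v` other than `u`;
    -- `∑-update` takes care of the exceptional index.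
    f g : Fin n → ℕ
    f v = d p v + A v u * same (lookup p v) (not (lookup p u))
    g v = d (flip u p) v + A v u * same (lookup p v) (lookup p u)
    ∑f : sum f ≡ E p + d′
    ∑f = trans (∑-+ (d p) _) (cong (E p +_) (∑-cong opp))
      where
      opp : ∀ v → A v u * same (lookup p v) (not (lookup p u)) ≡
                  A u v * same (lookup (flip u p) u) (lookup (flip u p) v)
      opp v with v ≟ u
      ... | yes refl rewrite A-irrefl u = refl
      ... | no v≢u rewrite flip-hit u p | flip-miss p v≢u =
        cong₂ _*_ (A-sym v u) (same-sym (lookup p v) (not (lookup p u)))
    ∑g : sum g ≡ E′ + d p u
    ∑g = trans (∑-+ (d (flip u p)) _) (cong (E′ +_) (∑-cong λ v →
           cong₂ _*_ (A-sym v u) (same-sym (lookup p v) (lookup p u))))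
    update : E′ + d p u + d p u ≡ E p + d′ + d′
    update = begin
      E′ + d p u + d p u ≡⟨ cong₂ _+_ ∑g (trans (cong (λ a → d p u + a * same (lookup p u) (not (lookup p u))) (A-irrefl u)) (ℕ.+-identityʳ (d p u))) ⟨
      sum g + f u        ≡⟨ ∑-update u (λ v → d-flip-other p {u} {v}) ⟩
      sum f + g u        ≡⟨ cong₂ _+_ ∑f (trans (cong (λ a → d′ + a * same (lookup p u) (lookup p u)) (A-irrefl u)) (ℕ.+-identityʳ d′)) ⟩
      E p + d′ + d′      ∎

  opposite : ∀ (p : Subset n) {t u v} → lookup p u ≡ t → lookup p v ≡ not t → u ≢ v
  opposite p pu pv refl = not≢ pu pv

  -- Two flips contribute 6 each. At the second one `u` already has the colour of `v`, so the degree
  -- of `v` has grown by `A u v`.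
  E-swap : ∀ p {t u v} → lookup p u ≡ t → lookup p v ≡ not t →
    E (swap u v p) + 4 * (d p u + (d p v + A u v)) ≡ E p + 12
  E-swap p {t} {u} {v} pu pv = begin
    E (swap u v p) + 4 * (d p u + (d p v + A u v)) ≡⟨ cong (λ k → E (swap u v p) + 4 * (d p u + k)) (sym dv) ⟩
    E (swap u v p) + 4 * (d p u + d (flip u p) v)  ≡⟨ solve 3 (λ e a b → e :+ con 4 :* (a :+ b) := e :+ con 4 :* b :+ con 4 :* a) refl (E (swap u v p)) (d p u) _ ⟩
    E (swap u v p) + 4 * d (flip u p) v + 4 * d p u ≡⟨ cong (_+ 4 * d p u) (E-flip (flip u p) v) ⟩
    E (flip u p) + 6 + 4 * d p u                   ≡⟨ solve 2 (λ e a → e :+ con 6 :+ con 4 :* a := e :+ con 4 :* a :+ con 6) refl (E (flip u p)) (d p u) ⟩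
    E (flip u p) + 4 * d p u + 6                   ≡⟨ cong (_+ 6) (E-flip p u) ⟩
    E p + 6 + 6                                    ≡⟨ ℕ.+-assoc (E p) 6 6 ⟩
    E p + 12                                       ∎
    where
    open ≡-Reasoning
    v≢u : v ≢ u
    v≢u v≡u = opposite p pu pv (sym v≡u)
    dv : d (flip u p) v ≡ d p v + A u v
    dv = begin
      d (flip u p) v ≡⟨ ℕ.+-identityʳ _ ⟨
      d (flip u p) v + 0 ≡⟨ cong (d (flip u p) v +_) (ℕ.*-zeroʳ (A v u)) ⟨
      d (flip u p) v + A v u * 0 ≡⟨ cong (λ s → d (flip u p) v + A v u * s) s₀ ⟨
      d (flip u p) v + A v u * same (lookup p v) (lookup p u) ≡⟨ d-flip-other p v≢u ⟩
      d p v + A v u * same (lookup p v) (not (lookup p u)) ≡⟨ cong (λ s → d p v + A v u * s) s₁ ⟩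
      d p v + A v u * 1 ≡⟨ cong (d p v +_) (trans (ℕ.*-identityʳ (A v u)) (A-sym v u)) ⟩
      d p v + A u v ∎
      where
      s₀ : same (lookup p v) (lookup p u) ≡ 0
      s₀ = trans (same-sym (lookup p v) _) (trans (cong (λ s → same s (lookup p v)) pu) (same-opp pv))
      s₁ : same (lookup p v) (not (lookup p u)) ≡ 1
      s₁ = trans (cong₂ same pv (cong not pu)) (same-refl refl)

  Balanced : Subset n → Set
  Balanced p = ∣ p ∣ + ∣ p ∣ ≡ n

  size-flip : ∀ u p → ∣ flip u p ∣ + bit (lookup p u) ≡ ∣ p ∣ + bit (not (lookup p u))
  size-flip u p = begin
    ∣ flip u p ∣ + bit (lookup p u)
      ≡⟨ cong (_+ bit (lookup p u)) (∣∣≡∑ (flip u p)) ⟩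
    sum (λ i → bit (lookup (flip u p) i)) + bit (lookup p u)
      ≡⟨ ∑-update u (λ i i≢u → cong bit (flip-miss p i≢u)) ⟩
    sum (λ i → bit (lookup p i)) + bit (lookup (flip u p) u)
      ≡⟨ cong₂ _+_ (sym (∣∣≡∑ p)) (cong bit (flip-hit u p)) ⟩
    ∣ p ∣ + bit (not (lookup p u)) ∎
    where open ≡-Reasoning

  module _ (p : Subset n) {t u v} (pu : lookup p u ≡ t) (pv : lookup p v ≡ not t) where

    swap-out : lookup (swap u v p) u ≡ not t
    swap-out = trans (flip-miss (flip u p) (opposite p pu pv)) (trans (flip-hit u p) (cong not pu))

    swap-in : lookup (swap u v p) v ≡ t
    swap-in = trans (flip-hit v (flip u p))
      (trans (cong not (trans (flip-miss p (≢-sym (opposite p pu pv))) pv)) (not-involutive t))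

    swap-balanced : Balanced p → Balanced (swap u v p)
    swap-balanced bal = trans (cong (λ k → k + k) size) bal
      where
      f = flip u p
      fv : lookup f v ≡ lookup p v
      fv = flip-miss p (≢-sym (opposite p pu pv))
      size : ∣ swap u v p ∣ ≡ ∣ p ∣
      size = ℕ.+-cancelʳ-≡ (bit (lookup p u) + bit (lookup p v)) _ _ (begin
        ∣ swap u v p ∣ + (bit (lookup p u) + bit (lookup p v))
          ≡⟨ solve 3 (λ a b c → a :+ (b :+ c) := a :+ c :+ b) refl ∣ swap u v p ∣ (bit (lookup p u)) _ ⟩
        ∣ swap u v p ∣ + bit (lookup p v) + bit (lookup p u)
          ≡⟨ cong (_+ bit (lookup p u)) (subst (λ s → ∣ swap u v p ∣ + bit s ≡ ∣ f ∣ + bit (not s)) fv (size-flip v f)) ⟩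
        ∣ f ∣ + bit (not (lookup p v)) + bit (lookup p u)
          ≡⟨ solve 3 (λ a b c → a :+ b :+ c := a :+ c :+ b) refl ∣ f ∣ (bit (not (lookup p v))) _ ⟩
        ∣ f ∣ + bit (lookup p u) + bit (not (lookup p v))
          ≡⟨ cong (_+ bit (not (lookup p v))) (size-flip u p) ⟩
        ∣ p ∣ + bit (not (lookup p u)) + bit (not (lookup p v))
          ≡⟨ ℕ.+-assoc ∣ p ∣ _ _ ⟩
        ∣ p ∣ + (bit (not (lookup p u)) + bit (not (lookup p v)))
          ≡⟨ cong (∣ p ∣ +_) (bit-not (lookup p v) (lookup p u) (trans pv (cong not (sym pu)))) ⟩
        ∣ p ∣ + (bit (lookup p u) + bit (lookup p v)) ∎)
        where open ≡-Reasoning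

  swap-miss : ∀ p {u v x} → x ≢ u → x ≢ v → lookup (swap u v p) x ≡ lookup p x
  swap-miss p {u} x≢u x≢v = trans (flip-miss (flip u p) x≢v) (flip-miss p x≢u)

  d-swap-far : ∀ p {u v x} → x ≢ u → x ≢ v → ¬ Adj x u → ¬ Adj x v → d (swap u v p) x ≡ d p x
  d-swap-far p {u} {v} {x} x≢u x≢v ¬xu ¬xv = ∑-cong term
    where
    term : ∀ w → A x w * same (lookup (swap u v p) x) (lookup (swap u v p) w) ≡
                 A x w * same (lookup p x) (lookup p w)
    term w with adj? x w
    ... | no _   = refl
    ... | yes xw = cong (1 *_) (cong₂ same (swap-miss p x≢u x≢v)
      (swap-miss p (λ { refl → ¬xu xw }) (λ { refl → ¬xv xw })))

  -- Balanced colourings of minimal energy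

  record EMin (p : Subset n) : Set where
    constructor emin
    field
      balanced : Balanced p
      minimal  : ∀ q → Balanced q → E p ≤ E q

  -- By `E-swap`, a swap changes `E` by 12 minus four times the left side, and it keeps the balance.
  -- A larger left side would therefore lower the energy.
  swap-bound : ∀ {p t u v} → EMin p → lookup p u ≡ t → lookup p v ≡ not t →
    d p u + (d p v + A u v) ≤ 3
  swap-bound {p} {t} {u} {v} (emin bal min) pu pv =
    ℕ.*-cancelˡ-≤ 4 (ℕ.+-cancelˡ-≤ (E p) _ _ (begin
      E p + 4 * (d p u + (d p v + A u v))
        ≤⟨ ℕ.+-monoˡ-≤ _ (min (swap u v p) (swap-balanced p pu pv bal)) ⟩
      E (swap u v p) + 4 * (d p u + (d p v + A u v))
        ≡⟨ E-swap p pu pv ⟩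
      E p + 12 ∎))
    where open ℕ.≤-Reasoning

  swap-tie : ∀ {p t u v} → EMin p → lookup p u ≡ t → lookup p v ≡ not t →
    d p u + (d p v + A u v) ≡ 3 → EMin (swap u v p)
  swap-tie {p} {t} {u} {v} (emin bal min) pu pv tie =
    emin (swap-balanced p pu pv bal) λ q q-bal → ℕ.≤-trans (ℕ.≤-reflexive E≡) (min q q-bal)
    where
    E≡ : E (swap u v p) ≡ E p
    E≡ = ℕ.+-cancelʳ-≡ 12 _ _
      (trans (cong (λ k → E (swap u v p) + 4 * k) (sym tie)) (E-swap p pu pv))

  EMin-E : ∀ {p q} → EMin p → EMin q → E p ≡ E q
  EMin-E {p} {q} (emin balp minp) (emin balq minq) = ℕ.≤-antisym (minp q balq) (minq p balp)

  -- Counting edges by the colours of their ends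

  count : Bool → Subset n → ℕ
  count s p = sum (λ x → same s (lookup p x))

  count+count : ∀ t p → count t p + count (not t) p ≡ n
  count+count t p = trans (sym (∑-+ {n} _ _))
    (trans (∑-cong {n} λ x → trans (ℕ.+-comm (same t (lookup p x)) _) (same+opp t (lookup p x)))
           (∑1 n))
    where
    ∑1 : ∀ m → sum {m} (λ _ → 1) ≡ m
    ∑1 zero    = refl
    ∑1 (suc m) = cong suc (∑1 m)

  count-balanced : ∀ t {p} → Balanced p → count t p ≡ count (not t) p
  count-balanced true {p} bal = ℕ.+-cancelˡ-≡ (count true p) _ _
    (trans (cong (λ k → k + k) (sym size)) (trans bal (sym (count+count true p))))
    where
    size : ∣ p ∣ ≡ count true p
    size = trans (∣∣≡∑ p) (∑-cong λ x → bit≡same (lookup p x))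
  count-balanced false {p} bal = sym (count-balanced true {p} bal)

  mono : Bool → Subset n → ℕ
  mono s p = sum (λ x → same s (lookup p x) * d p x)

  cross : Bool → Subset n → ℕ
  cross s p = sum (λ x → sum (λ y → A x y * (same s (lookup p x) * same (not s) (lookup p y))))

  -- The three edges at a vertex of colour `s` either stay inside the colour or cross. Here `mono`
  -- counts an inner edge twice and `cross` counts a crossing edge once.
  mono+cross : ∀ s p → mono s p + cross s p ≡ 3 * count s p
  mono+cross s p = trans (sym (∑-+ {n} _ _)) (trans (∑-cong row)
    (sym (∑-scale 3 (λ x → same s (lookup p x)))))
    where
    open ≡-Reasoning
    row : ∀ x → same s (lookup p x) * d p x +
                sum (λ y → A x y * (same s (lookup p x) * same (not s) (lookup p y))) ≡
                3 * same s (lookup p x)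
    row x = begin
      σ * d p x + sum (λ y → A x y * (σ * same (not s) (lookup p y)))
        ≡⟨ cong (_+ sum (λ y → A x y * (σ * same (not s) (lookup p y))))
                (∑-scale σ (λ y → A x y * same (lookup p x) (lookup p y))) ⟩
      sum (λ y → σ * (A x y * same (lookup p x) (lookup p y))) +
      sum (λ y → A x y * (σ * same (not s) (lookup p y)))
        ≡⟨ ∑-+ {n} _ _ ⟨
      sum (λ y → σ * (A x y * same (lookup p x) (lookup p y)) +
                 A x y * (σ * same (not s) (lookup p y)))
        ≡⟨ ∑-cong (λ y → trans
             (solve 4 (λ σ a m o → σ :* (a :* m) :+ a :* (σ :* o) := (σ :* m :+ σ :* o) :* a) refl
                σ (A x y) (same (lookup p x) (lookup p y)) (same (not s) (lookup p y)))
             (cong (_* A x y) (same-split s (lookup p x) (lookup p y)))) ⟩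
      sum (λ y → σ * A x y)
        ≡⟨ ∑-scale σ (A x) ⟨
      σ * sum (A x)
        ≡⟨ cong (σ *_) (∑A≡3 x) ⟩
      σ * 3
        ≡⟨ ℕ.*-comm σ 3 ⟩
      3 * σ ∎
      where σ = same s (lookup p x)

  cross-sym : ∀ t p → cross t p ≡ cross (not t) p
  cross-sym t p = trans (∑-comm {n} {n} _) (∑-cong {n} λ y → ∑-cong {n} λ x →
    cong₂ _*_ (A-sym x y) (trans (ℕ.*-comm (same t (lookup p x)) (same (not t) (lookup p y)))
      (cong (λ s → same (not t) (lookup p y) * same s (lookup p x)) (sym (not-involutive t)))))

  -- Both classes have the same number of edge ends, and the crossing edges use up equally many of
  -- each.
  mono-balanced : ∀ t {p} → Balanced p → mono t p ≡ mono (not t) p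
  mono-balanced t {p} bal = ℕ.+-cancelʳ-≡ (cross t p) _ _ (begin
    mono t p + cross t p             ≡⟨ mono+cross t p ⟩
    3 * count t p                    ≡⟨ cong (3 *_) (count-balanced t {p} bal) ⟩
    3 * count (not t) p              ≡⟨ mono+cross (not t) p ⟨
    mono (not t) p + cross (not t) p ≡⟨ cong (mono (not t) p +_) (cross-sym t p) ⟨
    mono (not t) p + cross t p       ∎)
    where open ≡-Reasoning

  d≤3 : ∀ p x → d p x ≤ 3
  d≤3 p x = ℕ.≤-trans (ℕ.m≤n+m _ _) (ℕ.≤-reflexive (d-flip p x))

  -- If `d p x` were 3, `swap-bound` would force degree 0 on all vertices of the other colour. That
  -- colour would have no monochromatic edges while the colour of `x` has some, against
  -- `mono-balanced`.
  d≤2 : ∀ {p} → EMin p → ∀ x → d p x ≤ 2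
  d≤2 {p} min x with ℕ.m≤n⇒m<n∨m≡n (d≤3 p x)
  ... | inj₁ (s≤s d≤2) = d≤2
  ... | inj₂ d≡3 = contradiction (begin
      d p x                      ≡⟨ ℕ.*-identityˡ (d p x) ⟨
      1 * d p x                  ≡⟨ cong (_* d p x) (same-refl {t} refl) ⟨
      same t (lookup p x) * d p x ≤⟨ ∑-≥ (λ x → same t (lookup p x) * d p x) x ⟩
      mono t p                   ≡⟨ mono-balanced t {p} (EMin.balanced min) ⟩
      mono (not t) p             ≡⟨ ∑-zero others ⟩
      0                          ∎) (subst (λ k → ¬ k ≤ 0) (sym d≡3) λ ())
    where
    open ℕ.≤-Reasoning
    t = lookup p x
    others : ∀ y → same (not t) (lookup p y) * d p y ≡ 0
    others y with either t (lookup p y)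
    ... | inj₁ py = cong (_* d p y) (same-opp (trans py (sym (not-involutive t))))
    ... | inj₂ py = trans (cong (same (not t) (lookup p y) *_) dy≡0) (ℕ.*-zeroʳ (same (not t) (lookup p y)))
      where
      dy≡0 : d p y ≡ 0
      dy≡0 = ℕ.n≤0⇒n≡0 (ℕ.≤-trans (ℕ.m≤m+n _ _) (ℕ.+-cancelˡ-≤ 3 _ 0
        (subst (λ k → k + (d p y + A x y) ≤ 3) d≡3 (swap-bound {p} min refl py))))

  -- The extremal colouring

  BadPair : Subset n → Fin n → Fin n → Set
  BadPair p x y = Adj x y × lookup p x ≡ lookup p y × 2 ≤ d p x × 2 ≤ d p y

  Bad : Subset n → Fin n → Set
  Bad p x = ∃ (BadPair p x)

  bad? : ∀ p x → Dec (Bad p x)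
  bad? p x = any? λ y →
    adj? x y ×-dec (lookup p x Bool.≟ lookup p y) ×-dec (2 ℕ.≤? d p x) ×-dec (2 ℕ.≤? d p y)

  bads : Subset n → Subset n
  bads p = tabulate (λ x → does (bad? p x))

  ∈-bads : ∀ p {x} → Bad p x → x ∈ bads p
  ∈-bads p {x} bad = lookup⇒[]= x (bads p)
    (trans (lookup∘tabulate (λ x → does (bad? p x)) x) (dec-true (bad? p x) bad))

  bads-∈ : ∀ p {x} → x ∈ bads p → Bad p x
  bads-∈ p {x} x∈ with bad? p x | trans (sym (lookup∘tabulate (λ x → does (bad? p x)) x)) ([]=⇒lookup x∈)
  ... | yes bad | _ = bad
  ... | no _    | ()

  record Min (p : Subset n) : Set where
    field
      energy-min : EMin p
      bads-min   : ∀ q → EMin q → ∣ bads p ∣ ≤ ∣ bads q ∣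

  -- The degree sum `3n` is even by `∑∑-even`, say `2k`, and then `n` is twice `k - n`.
  n-even : ∃ λ k → k + k ≡ n
  n-even with k , eq ← ∑∑-even A A-sym A-irrefl =
    j , ℕ.+-cancelˡ-≡ (n + n) _ _ (begin
      (n + n) + (j + j) ≡⟨ solve 2 (λ n j → (n :+ n) :+ (j :+ j) := (n :+ j) :+ (n :+ j)) refl n j ⟩
      (n + j) + (n + j) ≡⟨ cong (λ k → k + k) (ℕ.m+[n∸m]≡n n≤k) ⟩
      k + k             ≡⟨ 3n≡k+k ⟨
      n * 3             ≡⟨ solve 1 (λ n → n :* con 3 := n :+ n :+ n) refl n ⟩
      (n + n) + n       ∎)
    where
    open ≡-Reasoning
    j = k ∸ n
    ∑3 : ∀ m → sum {m} (λ _ → 3) ≡ m * 3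
    ∑3 zero    = refl
    ∑3 (suc m) = cong (3 +_) (∑3 m)
    3n≡k+k : n * 3 ≡ k + k
    3n≡k+k = trans (sym (∑3 n)) (trans (sym (∑-cong ∑A≡3)) eq)
    n≤k : n ≤ k
    n≤k = ℕ.≮⇒≥ λ k<n → ℕ.<-irrefl (sym 3n≡k+k) (ℕ.<-≤-trans (ℕ.+-mono-< k<n k<n)
      (ℕ.≤-trans (ℕ.m≤m+n (n + n) n)
        (ℕ.≤-reflexive (solve 1 (λ n → n :+ n :+ n := n :* con 3) refl n))))

  -- Two successive minimisations give the lexicographic minimum: first `E` over balanced
  -- colourings, then the number of bad vertices among those with the least `E`.
  min-exists : ∃ Min
  min-exists
    with k , k+k≡n ← n-even
    with p₀ , ∣p₀∣≡k ← subset-of-size n (ℕ.≤-trans (ℕ.m≤m+n k k) (ℕ.≤-reflexive k+k≡n))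
    with p₁ , bal₁ , min₁ ← argmin {P = Balanced} (λ p → ∣ p ∣ + ∣ p ∣ ℕ.≟ n) E
                              (p₀ , trans (cong (λ k → k + k) ∣p₀∣≡k) k+k≡n)
    with p , (bal , E≡) , min ← argmin {P = λ p → Balanced p × E p ≡ E p₁}
                              (λ p → (∣ p ∣ + ∣ p ∣ ℕ.≟ n) ×-dec (E p ℕ.≟ E p₁)) (λ p → ∣ bads p ∣)
                              (p₁ , bal₁ , refl)
    = p , record
      { energy-min = emin bal λ q bal-q → ℕ.≤-trans (ℕ.≤-reflexive E≡) (min₁ q bal-q)
      ; bads-min   = λ q q-min → min q (EMin.balanced q-min , EMin-E q-min (emin {p₁} bal₁ min₁))
      }

  -- If `b` were no longer bad, the bad vertices of `q` would form a proper subset of those of `p`.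
  no-fewer-bads : ∀ {p q b} → Min p → EMin q → (∀ {x} → Bad q x → Bad p x) → Bad p b → ¬ ¬ Bad q b
  no-fewer-bads {p} {q} {b} min q-min q⊆p bad ¬bad = ℕ.<⇒≱
    (p⊂q⇒∣p∣<∣q∣ ((λ x∈ → ∈-bads p (q⊆p (bads-∈ q x∈))) , b , ∈-bads p bad , ¬bad ∘ bads-∈ q))
    (Min.bads-min min q q-min)

  -- Degrees read off from a neighbourhood

  d-eval : ∀ {x a b c} q → Nb x a b c → ∀ {s i j k} →
    lookup q x ≡ s → lookup q a ≡ i → lookup q b ≡ j → lookup q c ≡ k →
    d q x ≡ same s i + (same s j + same s k)
  d-eval q N refl refl refl refl = ∑nb N _

  2≤d : ∀ q {x a e f s} → Nb x a e f →
    lookup q x ≡ s → lookup q a ≡ s → lookup q e ≡ s → 2 ≤ d q x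
  2≤d q {f = f} {s} N qx qa qe = subst (2 ≤_) (sym (d-eval q N qx qa qe refl))
    (subst (λ i → 2 ≤ i + (i + same s (lookup q f))) (sym (same-refl {s} refl)) (s≤s (s≤s z≤n)))

  d-≤1 : ∀ {x a b c t} q → Nb x a b c →
    lookup q x ≡ t → lookup q a ≡ not t → lookup q b ≡ not t → d q x ≤ 1
  d-≤1 {c = c} {t = t} q N qx qa qb = subst (_≤ 1) (sym (d-eval q N qx qa qb refl))
    (subst (λ i → i + (i + same t (lookup q c)) ≤ 1) (sym (same-opp {t = t} refl)) (same≤1 t _))

  focus : ∀ {x w} → Adj x w → ∃ λ e → ∃ λ f → Nb x w e f
  focus {x} xw with a , b , c , N ← neighbourhood x with nb-cover N xw
  ... | inj₁ refl        = b , c , N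
  ... | inj₂ (inj₁ refl) = c , a , nb-rotate N
  ... | inj₂ (inj₂ refl) = a , b , nb-rotate (nb-rotate N)

  d-mono : ∀ {p q t x} → lookup p x ≡ t → lookup q x ≡ t →
    (∀ w → Adj x w → lookup q w ≡ t → lookup p w ≡ t) → d q x ≤ d p x
  d-mono {p} {q} {t} {x} px qx sub = ∑-mono-≤ term
    where
    term : ∀ w → A x w * same (lookup q x) (lookup q w) ≤ A x w * same (lookup p x) (lookup p w)
    term w with adj? x w
    ... | no _   = z≤n
    ... | yes xw rewrite px | qx with either t (lookup q w)
    ... | inj₁ qw rewrite qw | sub w xw qw = ℕ.≤-refl
    ... | inj₂ qw rewrite same-opp qw = z≤n

  isolated : ∀ {p x t w} → lookup p x ≡ t → d p x ≡ 0 → Adj x w → lookup p w ≡ not t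
  isolated {p} {x} {t} {w} px dx xw with e , f , N ← focus xw with either t (lookup p w)
  ... | inj₂ pw = pw
  ... | inj₁ pw = contradiction (trans (sym dx) (d-eval p N px pw refl refl))
                    (subst (λ i → 0 ≢ i + (same t (lookup p e) + same t (lookup p f))) (sym (same-refl {t} refl)) λ ())

  -- The opposite colour is a parameter with an equation, so that for `s` equal to `not t` it can be
  -- `t` itself instead of `not (not t)`.
  pendant : ∀ {p x s s′} → s′ ≡ not s → lookup p x ≡ s → d p x ≡ 1 →
    ∃ λ a → ∃ λ b → ∃ λ c → Nb x a b c × lookup p a ≡ s × lookup p b ≡ s′ × lookup p c ≡ s′
  pendant {p} {x} {s} refl px dx with a , b , c , N ← neighbourhood x
    with either s (lookup p a) | either s (lookup p b) | either s (lookup p c)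
  ... | inj₁ pa | inj₂ pb | inj₂ pc = a , b , c , N , pa , pb , pc
  ... | inj₂ pa | inj₁ pb | inj₂ pc = b , c , a , nb-rotate N , pb , pc , pa
  ... | inj₂ pa | inj₂ pb | inj₁ pc = c , a , b , nb-rotate (nb-rotate N) , pc , pa , pb
  ... | inj₁ pa | inj₁ pb | inj₁ pc = contradiction (trans (sym dx) (d-eval p N px pa pb pc))
    (subst (λ i → 1 ≢ i + (i + i)) (sym (same-refl {s} refl)) λ ())
  ... | inj₁ pa | inj₁ pb | inj₂ pc = contradiction (trans (sym dx) (d-eval p N px pa pb pc))
    (subst (λ i → 1 ≢ i + (i + same s (not s))) (sym (same-refl {s} refl)) λ ())
  ... | inj₁ pa | inj₂ pb | inj₁ pc = contradiction (trans (sym dx) (d-eval p N px pa pb pc))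
    (subst₂ (λ i j → 1 ≢ i + (j + i)) (sym (same-refl {s} refl)) (sym (same-opp {t = s} refl)) λ ())
  ... | inj₂ pa | inj₁ pb | inj₁ pc = contradiction (trans (sym dx) (d-eval p N px pa pb pc))
    (subst₂ (λ i j → 1 ≢ j + (i + i)) (sym (same-refl {s} refl)) (sym (same-opp {t = s} refl)) λ ())
  ... | inj₂ pa | inj₂ pb | inj₂ pc = contradiction (trans (sym dx) (d-eval p N px pa pb pc))
    (subst (λ j → 1 ≢ j + (j + j)) (sym (same-opp {t = s} refl)) λ ())

  -- A bad pair in an extremal colouring is contradictory

  module BadPairMoves (p : Subset n) (min : Min p) (b c : Fin n) (bad : BadPair p b c) where

    t : Bool
    t = lookup p b

    White Black : Fin n → Set
    White x = lookup p x ≡ t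
    Black x = lookup p x ≡ not t

    p-min : EMin p
    p-min = Min.energy-min min

    b∼c : Adj b c
    b∼c = proj₁ bad

    white-b : White b
    white-b = refl

    white-c : White c
    white-c = sym (proj₁ (proj₂ bad))

    d-b : d p b ≡ 2
    d-b = ℕ.≤-antisym (d≤2 p-min b) (proj₁ (proj₂ (proj₂ bad)))

    d-c : d p c ≡ 2
    d-c = ℕ.≤-antisym (d≤2 p-min c) (proj₂ (proj₂ (proj₂ bad)))

    heavy : ∀ {q u v s} → EMin q → lookup q u ≡ s → lookup q v ≡ not s → 2 ≤ d q u → d q v + A u v ≤ 1
    heavy {q} {u} {v} q-min qu qv 2≤du = ℕ.+-cancelˡ-≤ 2 _ _
      (ℕ.≤-trans (ℕ.+-monoˡ-≤ (d q v + A u v) 2≤du) (swap-bound q-min qu qv))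

    black≤1 : ∀ v → Black v → d p v ≤ 1
    black≤1 v pv = ℕ.≤-trans (ℕ.m≤m+n _ _) (heavy p-min white-b pv (ℕ.≤-reflexive (sym d-b)))

    -- In `heavy` only one unit is left for `v`; its degree uses this up and leaves none for an edge
    -- to `u`.
    heavy≁ : ∀ {u v} → White u → 2 ≤ d p u → Black v → d p v ≡ 1 → ¬ Adj u v
    heavy≁ {u} {v} pu 2≤du pv dv uv = contradiction (heavy p-min pu pv 2≤du)
      (subst₂ (λ i j → ¬ i + j ≤ 1) (sym dv) (sym (A-adj uv)) λ { (s≤s ()) })

    b≁ : ∀ {v} → Black v → d p v ≡ 1 → ¬ Adj b v
    b≁ = heavy≁ white-b (ℕ.≤-reflexive (sym d-b))

    light≢b : ∀ {x} → d p x ≤ 1 → x ≢ b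
    light≢b dx refl = contradiction (subst (_≤ 1) d-b dx) λ { (s≤s ()) }

    W≢B : ∀ {x y} → White x → Black y → x ≢ y
    W≢B = opposite p

    B≢W : ∀ {x y} → Black x → White y → x ≢ y
    B≢W px py x≡y = opposite p py px (sym x≡y)

    -- The bad pairs of q lie away from the vertices i₁, i₂ that became white, so
    -- they are bad in p already, while b is no longer bad.
    no-progress : ∀ {q g i₁ i₂} → EMin q → lookup q b ≡ not t →
      lookup q g ≡ t → 2 ≤ d q g →
      (∀ x → lookup q x ≡ t → x ≢ i₁ → x ≢ i₂ → White x) →
      (∀ k k′ → lookup q k ≡ t → lookup q k′ ≡ t → Adj k k′ → 2 ≤ d q k → 2 ≤ d q k′ →
        (k ≢ i₁ × k ≢ i₂) × (¬ Adj k i₁ × ¬ Adj k i₂)) →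
      ⊥
    no-progress {q} {g} {i₁} {i₂} q-min qb qg 2≤dg old far =
      no-fewer-bads min q-min old-bad (c , bad) λ { (_ , _ , _ , 2≤db , _) → black qb 2≤db }
      where
      -- By `heavy`, the white vertex `g` of degree 2 bounds every black degree by 1, so all bad
      -- vertices of `q` are white.
      black : ∀ {x} → lookup q x ≡ not t → ¬ 2 ≤ d q x
      black qx 2≤dx = contradiction
        (ℕ.≤-trans 2≤dx (ℕ.≤-trans (ℕ.m≤m+n _ _) (heavy q-min qg qx 2≤dg))) λ { (s≤s ()) }
      old-white : ∀ {k k′} → lookup q k ≡ t → lookup q k′ ≡ t → Adj k k′ → 2 ≤ d q k → 2 ≤ d q k′ →
        White k × 2 ≤ d p k
      old-white {k} {k′} qk qk′ kk′ 2≤dk 2≤dk′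
        with (k≢i₁ , k≢i₂) , (k≁i₁ , k≁i₂) ← far k k′ qk qk′ kk′ 2≤dk 2≤dk′ =
        -- None of the white neighbours of `k` in `q` is new, so its degree in `p` is at least as
        -- large.
        old k qk k≢i₁ k≢i₂ , ℕ.≤-trans 2≤dk (d-mono {p} {q} (old k qk k≢i₁ k≢i₂) qk
          λ w kw qw → old w qw (λ { refl → k≁i₁ kw }) (λ { refl → k≁i₂ kw }))
      old-bad : ∀ {x} → Bad q x → Bad p x
      old-bad {x} (y , xy , q≡ , 2≤dx , 2≤dy) with either t (lookup q x)
      ... | inj₂ qx = contradiction 2≤dx (black qx)
      ... | inj₁ qx
        with qy ← trans (sym q≡) qx
        with px , 2≤px ← old-white qx qy xy 2≤dx 2≤dy
           | py , 2≤py ← old-white qy qx (adj-sym xy) 2≤dy 2≤dx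
        = y , xy , trans px (sym py) , 2≤px , 2≤py

    -- Local configurations excluded by extremality

    b-tie : ∀ {v} → Black v → d p v ≡ 1 → EMin (swap b v p)
    b-tie {v} pv dv = swap-tie p-min white-b pv
      (cong₂ _+_ d-b (cong₂ _+_ dv (A-nonadj (b≁ pv dv))))

    -- Swap `b` with `v`. Then `v` is the centre of a white path `y v z` whose ends have no further
    -- white neighbours, so no new bad pair arises while `b` turns black.
    not-both-isolated : ∀ {v m y z} → Nb v m y z → Black v → d p v ≡ 1 → Black m →
      White y → White z → d p y ≡ 0 → d p z ≡ 0 → ⊥
    not-both-isolated {v} {m} {y} {z} N pv dv pm py pz dy dz =
      no-progress (b-tie pv dv) (swap-out p white-b pv) qv 2≤dv old
        λ k k′ qk qk′ kk′ 2≤dk 2≤dk′ →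
          let k≢v = λ { refl → centre k′ qk′ kk′ 2≤dk′ }
              k≁v = λ kv → centre k qk (adj-sym kv) 2≤dk
          in (k≢v , k≢v) , (k≁v , k≁v)
      where
      q = swap b v p
      qv : lookup q v ≡ t
      qv = swap-in p white-b pv
      stay-white : ∀ {x} → White x → x ≢ b → lookup q x ≡ t
      stay-white px x≢b = trans (swap-miss p x≢b (W≢B px pv)) px
      stay-black : ∀ {x} → Black x → x ≢ v → lookup q x ≡ not t
      stay-black px x≢v = trans (swap-miss p (B≢W px white-b) x≢v) px
      leaf : ∀ {x} → White x → d p x ≡ 0 → Adj v x → lookup q x ≡ t × d q x ≤ 1
      leaf {x} px dx vx with e , f , M ← focus (adj-sym vx) = qx , d-≤1 q (nb-rotate M) qx qe qf
        where
        qx = stay-white px (light≢b (subst (_≤ 1) (sym dx) z≤n))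
        qe = stay-black (isolated {p} px dx (nb-adj₂ M)) (≢-sym (nb-≢ M))
        qf = stay-black (isolated {p} px dx (nb-adj₃ M)) (nb-≢ (nb-rotate (nb-rotate M)))
      y-leaf = leaf py dy (nb-adj₂ N)
      z-leaf = leaf pz dz (nb-adj₃ N)
      qm = stay-black pm (≢-sym (nb-irrefl N))
      2≤dv : 2 ≤ d q v
      2≤dv = ℕ.≤-reflexive (sym (trans (d-eval q N qv qm (proj₁ y-leaf) (proj₁ z-leaf))
        (cong₂ (λ i j → i + (j + j)) (same-opp {t = t} refl) (same-refl {t} refl))))
      old : ∀ x → lookup q x ≡ t → x ≢ v → x ≢ v → White x
      old x qx x≢v _ with x ≟ b
      ... | yes refl = refl
      ... | no x≢b = trans (sym (swap-miss p x≢b x≢v)) qx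
      centre : ∀ k → lookup q k ≡ t → Adj v k → ¬ 2 ≤ d q k
      centre k qk vk 2≤dk with nb-cover N vk
      ... | inj₁ refl        = not≢ qk qm
      ... | inj₂ (inj₁ refl) = contradiction (ℕ.≤-trans 2≤dk (proj₂ y-leaf)) λ { (s≤s ()) }
      ... | inj₂ (inj₂ refl) = contradiction (ℕ.≤-trans 2≤dk (proj₂ z-leaf)) λ { (s≤s ()) }

    d≡1 : ∀ q {x a e f s s′} → s′ ≡ not s → Nb x a e f →
      lookup q x ≡ s → lookup q a ≡ s → lookup q e ≡ s′ → lookup q f ≡ s′ → d q x ≡ 1
    d≡1 q {s = s} refl N qx qa qe qf = trans (d-eval q N qx qa qe qf)
      (cong₂ (λ i j → i + (j + j)) (same-refl {s} refl) (same-opp {t = s} refl))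

    d≡2 : ∀ q {x a e f s} → Nb x a e f →
      lookup q x ≡ s → lookup q a ≡ not s → lookup q e ≡ s → lookup q f ≡ s → d q x ≡ 2
    d≡2 q {s = s} N qx qa qe qf = trans (d-eval q N qx qa qe qf)
      (cong₂ (λ i j → i + (j + j)) (same-opp {t = s} refl) (same-refl {s} refl))

    Light : Fin n → Set
    Light x = ∀ k → Adj x k → White k → d p k ≤ 1

    -- Trade b and z′ for v and w: the bad pair at b disappears, v becomes the
    -- centre of the path y v z, and s gets the new neighbour w.
    exchange : ∀ {v m y z z′ r w q w′ s} →
      Nb v m y z  → Black v → Black m → White y → d p y ≡ 0 →
      Nb z z′ v r → White z → White z′ → Black r →
      Nb z′ z w q → Black w → Black q →
      Nb w w′ z′ s → Black w′ → White s → Light s →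
      v ≢ w → r ≢ w → m ≢ w → s ≢ y → ⊥
    exchange {v} {m} {y} {z} {z′} {r} {w} {q} {w′} {s}
      Nv pv pm py dy Nz pz pz′ pr Nz′ pw pq Nw pw′ ps s-light v≢w r≢w m≢w s≢y =
      no-progress p₂-min qb qv 2≤dv old far
      where
      not-t = sym (not-involutive t)
      dv : d p v ≡ 1
      dv = d≡1 p not-t Nv pv pm py pz
      dw : d p w ≡ 1
      dw = d≡1 p not-t Nw pw pw′ pz′ ps
      dz : d p z ≡ 1
      dz = d≡1 p refl Nz pz pz′ pv pr
      dz′ : d p z′ ≡ 1
      dz′ = d≡1 p refl Nz′ pz′ pz pw pq
      z≢b : z ≢ b
      z≢b = light≢b (ℕ.≤-reflexive dz)
      z′≢b : z′ ≢ b
      z′≢b = light≢b (ℕ.≤-reflexive dz′)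
      y≢b : y ≢ b
      y≢b = light≢b (subst (_≤ 1) (sym dy) z≤n)
      z≢y : z ≢ y
      z≢y refl = contradiction (trans (sym dy) dz) λ ()
      z′≢y : z′ ≢ y
      z′≢y refl = contradiction (trans (sym dy) dz′) λ ()
      s≢z′ : s ≢ z′
      s≢z′ = ≢-sym (nb-≢ (nb-rotate Nw))
      z≁w : ¬ Adj z w
      z≁w zw with nb-cover Nz zw
      ... | inj₁ refl        = B≢W pw pz′ refl
      ... | inj₂ (inj₁ refl) = v≢w refl
      ... | inj₂ (inj₂ refl) = r≢w refl
      v≁w : ¬ Adj v w
      v≁w vw with nb-cover Nv vw
      ... | inj₁ refl        = m≢w refl
      ... | inj₂ (inj₁ refl) = B≢W pw py refl
      ... | inj₂ (inj₂ refl) = B≢W pw pz refl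
      z′≁v : ¬ Adj z′ v
      z′≁v z′v with nb-cover Nz′ z′v
      ... | inj₁ refl        = B≢W pv pz refl
      ... | inj₂ (inj₁ refl) = v≢w refl
      ... | inj₂ (inj₂ refl) with nb-cover Nv (adj-sym z′v)
      ...   | inj₁ refl        = B≢W pm pz′ refl
      ...   | inj₂ (inj₁ refl) = z′≢y refl
      ...   | inj₂ (inj₂ refl) = nb-irrefl Nz′ refl
      z′≁b : ¬ Adj z′ b
      z′≁b z′b with nb-cover Nz′ z′b
      ... | inj₁ refl        = z≢b refl
      ... | inj₂ (inj₁ refl) = B≢W pw white-b refl
      ... | inj₂ (inj₂ refl) = B≢W pq white-b refl
      w′≢v : w′ ≢ v
      w′≢v refl = v≁w (adj-sym (nb-adj Nw))
      y≁w : ¬ Adj y w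
      y≁w yw with nb-cover Nw (adj-sym yw)
      ... | inj₁ refl        = B≢W pw′ py refl
      ... | inj₂ (inj₁ refl) = z′≢y refl
      ... | inj₂ (inj₂ refl) = s≢y refl
      p₁ p₂ : Subset n
      p₁ = swap b v p
      p₂ = swap z′ w p₁
      p₁z′ : lookup p₁ z′ ≡ t
      p₁z′ = trans (swap-miss p z′≢b (W≢B pz′ pv)) pz′
      p₁w : lookup p₁ w ≡ not t
      p₁w = trans (swap-miss p (B≢W pw white-b) (≢-sym v≢w)) pw
      p₂-min : EMin p₂
      -- Neither `z′` nor `w` touches `b` or `v`, so both still have degree 1 after the first swap;
      -- with the edge between them the sum is 3.
      p₂-min = swap-tie (b-tie pv dv) p₁z′ p₁w (cong₂ _+_
        (trans (d-swap-far p z′≢b (W≢B pz′ pv) z′≁b z′≁v) dz′)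
        (cong₂ _+_ (trans (d-swap-far p (B≢W pw white-b) (≢-sym v≢w) (b≁ pw dw ∘ adj-sym) (v≁w ∘ adj-sym)) dw)
                   (A-adj (nb-adj₂ Nz′))))
      stay-white : ∀ {x} → White x → x ≢ b → x ≢ z′ → lookup p₂ x ≡ t
      stay-white px x≢b x≢z′ =
        trans (swap-miss p₁ x≢z′ (W≢B px pw)) (trans (swap-miss p x≢b (W≢B px pv)) px)
      stay-black : ∀ {x} → Black x → x ≢ v → x ≢ w → lookup p₂ x ≡ not t
      stay-black px x≢v x≢w =
        trans (swap-miss p₁ (B≢W px pz′) x≢w) (trans (swap-miss p (B≢W px white-b) x≢v) px)
      qb : lookup p₂ b ≡ not t
      qb = trans (swap-miss p₁ (≢-sym z′≢b) (W≢B white-b pw)) (swap-out p white-b pv)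
      qv : lookup p₂ v ≡ t
      qv = trans (swap-miss p₁ (B≢W pv pz′) v≢w) (swap-in p white-b pv)
      qz′ : lookup p₂ z′ ≡ not t
      qz′ = swap-out p₁ p₁z′ p₁w
      qw : lookup p₂ w ≡ t
      qw = swap-in p₁ p₁z′ p₁w
      qy = stay-white py y≢b (≢-sym z′≢y)
      qz = stay-white pz z≢b (nb-irrefl Nz)
      qm = stay-black pm (≢-sym (nb-irrefl Nv)) m≢w
      qr = stay-black pr (nb-≢ (nb-rotate (nb-swap Nz))) r≢w
      qw′ = stay-black pw′ w′≢v (≢-sym (nb-irrefl Nw))
      2≤dv : 2 ≤ d p₂ v
      2≤dv = ℕ.≤-reflexive (sym (d≡2 p₂ Nv qv qm qy qz))
      light-y : ¬ 2 ≤ d p₂ y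
      light-y 2≤ with e , f , M ← focus (adj-sym (nb-adj₂ Nv)) = contradiction
        (ℕ.≤-trans 2≤ (d-≤1 p₂ (nb-rotate M) qy
          (stay-black (isolated {p} py dy ye) (≢-sym (nb-≢ M)) (λ { refl → y≁w ye }))
          (stay-black (isolated {p} py dy yf) (nb-≢ (nb-rotate (nb-rotate M))) (λ { refl → y≁w yf }))))
        λ { (s≤s ()) }
        where
        ye = nb-adj₂ M
        yf = nb-adj₃ M
      light-z : ¬ 2 ≤ d p₂ z
      light-z 2≤ = contradiction (ℕ.≤-trans 2≤ (d-≤1 p₂ (nb-swap Nz) qz qz′ qr)) λ { (s≤s ()) }
      light-w : ¬ 2 ≤ d p₂ w
      light-w 2≤ = contradiction (ℕ.≤-trans 2≤ (d-≤1 p₂ Nw qw qw′ qz′)) λ { (s≤s ()) }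
      old : ∀ x → lookup p₂ x ≡ t → x ≢ v → x ≢ w → White x
      old x qx x≢v x≢w with x ≟ b | x ≟ z′
      ... | yes refl | _        = refl
      ... | no _     | yes refl = pz′
      ... | no x≢b   | no x≢z′  = trans (sym (swap-miss p x≢b x≢v)) (trans (sym (swap-miss p₁ x≢z′ x≢w)) qx)
      near-v : ∀ k → lookup p₂ k ≡ t → Adj v k → ¬ 2 ≤ d p₂ k
      near-v k qk vk 2≤dk with nb-cover Nv vk
      ... | inj₁ refl        = not≢ qk qm
      ... | inj₂ (inj₁ refl) = light-y 2≤dk
      ... | inj₂ (inj₂ refl) = light-z 2≤dk
      s≁v : ¬ Adj s v
      s≁v sv with nb-cover Nv (adj-sym sv)
      ... | inj₁ refl        = B≢W pm ps refl
      ... | inj₂ (inj₁ refl) = s≢y refl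
      ... | inj₂ (inj₂ refl) = z≁w (adj-sym (nb-adj₃ Nw))
      -- Through its new neighbour `w` the vertex `s` may reach degree 2, so its white neighbours
      -- must be shown to stay at degree at most 1.
      near-s : ∀ k → lookup p₂ k ≡ t → Adj s k → ¬ 2 ≤ d p₂ k
      near-s k qk sk 2≤dk with k ≟ w | k ≟ v
      ... | yes refl | _        = light-w 2≤dk
      ... | no _     | yes refl = s≁v sk
      ... | no k≢w   | no k≢v   = contradiction
        (ℕ.≤-trans 2≤dk (ℕ.≤-trans
          (d-mono {p} {p₂} (old k qk k≢v k≢w) qk λ x kx qx → old x qx (λ { refl → k≁v kx }) (λ { refl → k≁w kx }))
          (s-light k sk (old k qk k≢v k≢w))))
        λ { (s≤s ()) }
        where
        k≁v : ¬ Adj k v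
        k≁v kv with nb-cover Nv (adj-sym kv)
        ... | inj₁ refl        = not≢ qk qm
        ... | inj₂ (inj₁ refl) = not≢ ps (isolated {p} py dy (adj-sym sk))
        ... | inj₂ (inj₂ refl) with nb-cover Nz (adj-sym sk)
        ...   | inj₁ refl        = s≢z′ refl
        ...   | inj₂ (inj₁ refl) = B≢W pv ps refl
        ...   | inj₂ (inj₂ refl) = B≢W pr ps refl
        k≁w : ¬ Adj k w
        k≁w kw with nb-cover Nw (adj-sym kw)
        ... | inj₁ refl        = not≢ qk qw′
        ... | inj₂ (inj₁ refl) = not≢ qk qz′
        ... | inj₂ (inj₂ refl) = irrefl refl sk
      far : ∀ k k′ → lookup p₂ k ≡ t → lookup p₂ k′ ≡ t → Adj k k′ → 2 ≤ d p₂ k → 2 ≤ d p₂ k′ →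
        (k ≢ v × k ≢ w) × (¬ Adj k v × ¬ Adj k w)
      far k k′ qk qk′ kk′ 2≤dk 2≤dk′ =
        ((λ { refl → near-v k′ qk′ kk′ 2≤dk′ }) , λ { refl → light-w 2≤dk }) ,
        ((λ kv → near-v k qk (adj-sym kv) 2≤dk) , k≁w)
        where
        k≁w : ¬ Adj k w
        k≁w kw with nb-cover Nw (adj-sym kw)
        ... | inj₁ refl        = not≢ qk qw′
        ... | inj₂ (inj₁ refl) = not≢ qk qz′
        ... | inj₂ (inj₂ refl) = near-s k′ qk′ kk′ 2≤dk′

    black-pendant : ∀ {v x} → Black v → d p v ≡ 1 → White x → Adj v x →
      ∃ λ m → ∃ λ o → Nb v m x o × Black m × White o
    black-pendant pv dv px vx
      with m , e , f , N , pm , pe , pf ← pendant {p} (sym (not-involutive t)) pv dv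
      with nb-cover N vx
    ... | inj₁ refl        = contradiction refl (B≢W pm px)
    ... | inj₂ (inj₁ refl) = m , f , N , pm , pf
    ... | inj₂ (inj₂ refl) = m , e , nb-swap N , pm , pe

    -- After swapping z and v, the black vertex q has degree 2, and so has b or c.
    black-mates : ∀ {z z′ v q} → Nb z z′ v q → White z → White z′ → Black v → Black q →
      d p v ≡ 1 → d p q ≡ 1 → ¬ ¬ Adj v q
    black-mates {z} {z′} {v} {q} Nz pz pz′ pv pq dv dq ¬vq = away (b ≟ z′)
      where
      dz : d p z ≡ 1
      dz = d≡1 p refl Nz pz pz′ pv pq
      p₁ = swap z v p
      p₁-min : EMin p₁
      p₁-min = swap-tie p-min pz pv (cong₂ _+_ dz (cong₂ _+_ dv (A-adj (nb-adj₂ Nz))))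
      p₁q : lookup p₁ q ≡ not t
      p₁q = trans (swap-miss p (B≢W pq pz) (≢-sym (nb-≢ (nb-rotate Nz)))) pq
      -- The old black neighbour `q′` of `q` is not `v`, which is not adjacent to `q`, and so it
      -- stays black; `z` has joined it.
      2≤dq : 2 ≤ d p₁ q
      2≤dq with q′ , o , Nq , pq′ , _ ← black-pendant pq dq pz (adj-sym (nb-adj₃ Nz)) =
        2≤d p₁ Nq p₁q
          (trans (swap-miss p (B≢W pq′ pz) λ { refl → ¬vq (adj-sym (nb-adj Nq)) }) pq′)
          (swap-out p pz pv)
      clash : ∀ g → White g → d p g ≡ 2 → g ≢ z′ → ⊥
      clash g pg dg g≢z′ = contradiction
        (ℕ.≤-trans 2≤dq (ℕ.≤-trans (ℕ.m≤m+n _ _) (heavy p₁-min p₁g p₁q (ℕ.≤-reflexive (sym dg₁)))))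
        λ { (s≤s ()) }
        where
        g≢z : g ≢ z
        g≢z refl = contradiction (trans (sym dg) dz) λ ()
        g≁z : ¬ Adj g z
        g≁z gz with nb-cover Nz (adj-sym gz)
        ... | inj₁ refl        = g≢z′ refl
        ... | inj₂ (inj₁ refl) = B≢W pv pg refl
        ... | inj₂ (inj₂ refl) = B≢W pq pg refl
        dg₁ : d p₁ g ≡ 2
        dg₁ = trans (d-swap-far p g≢z (W≢B pg pv) g≁z (heavy≁ pg (ℕ.≤-reflexive (sym dg)) pv dv)) dg
        p₁g : lookup p₁ g ≡ t
        p₁g = trans (swap-miss p g≢z (W≢B pg pv)) pg
      -- The swap may alter the degree of `z′`, but `b` and `c` are distinct, so one of them is not
      -- `z′` and keeps degree 2.
      away : Dec (b ≡ z′) → ⊥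
      away (no b≢z′)  = clash b white-b d-b b≢z′
      away (yes refl) = clash c white-c d-c λ { refl → irrefl refl b∼c }

    -- K₄ minus an edge on v, v′, z, y: after swapping (b , w) and (y , v), both at
    -- no cost, swapping z and v′ would lower the energy.
    no-diamond : ∀ {v v′ y z z′ w w′} →
      Nb v v′ z y → Nb v′ v z y → Black v → Black v′ → White y → White z →
      Nb z z′ v v′ → White z′ →
      Nb w w′ z′ y → Black w → Black w′ → v ≢ w → v′ ≢ w → ⊥
    no-diamond {v} {v′} {y} {z} {z′} {w} {w′} Nv Nv′ pv pv′ py pz Nz pz′ Nw pw pw′ v≢w v′≢w =
      -- The summands are 2 for `z`, 1 for `v′` and 1 for the edge between them, which exceeds 3.
      contradiction (swap-bound p₂-min p₂z p₂v′)
        (subst₂ (λ i j → ¬ i + j ≤ 3) (sym dz₂) (sym (cong₂ _+_ dv′₂ (A-adj zv′)))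
          λ { (s≤s (s≤s (s≤s ()))) })
      where
      not-t = sym (not-involutive t)
      zv′ = nb-adj₃ Nz
      dv : d p v ≡ 1
      dv = d≡1 p not-t Nv pv pv′ pz py
      dv′ : d p v′ ≡ 1
      dv′ = d≡1 p not-t Nv′ pv′ pv pz py
      dw : d p w ≡ 1
      dw = d≡1 p not-t Nw pw pw′ pz′ py
      v≁w : ¬ Adj v w
      v≁w vw with nb-cover Nv vw
      ... | inj₁ refl        = v′≢w refl
      ... | inj₂ (inj₁ refl) = B≢W pw pz refl
      ... | inj₂ (inj₂ refl) = B≢W pw py refl
      -- The vertex `y` is adjacent to the distinct vertices `w`, `v` and `v′`, so these are its
      -- whole neighbourhood.
      Ny : Nb y w v v′
      Ny with e , f , N ← focus (adj-sym (nb-adj₃ Nv))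
         with nb-cover N (adj-sym (nb-adj₃ Nv′))
            | nb-cover N (adj-sym (nb-adj₃ Nw))
      ... | inj₁ refl        | _                = contradiction refl (nb-irrefl Nv)
      ... | inj₂ _           | inj₁ refl        = contradiction refl v≢w
      ... | inj₂ (inj₁ refl) | inj₂ (inj₁ refl) = contradiction refl v′≢w
      ... | inj₂ (inj₁ refl) | inj₂ (inj₂ refl) = nb-rotate (nb-rotate N)
      ... | inj₂ (inj₂ refl) | inj₂ (inj₁ refl) = nb-swap (nb-rotate N)
      ... | inj₂ (inj₂ refl) | inj₂ (inj₂ refl) = contradiction refl v′≢w
      y≢b : y ≢ b
      y≢b refl = b≁ pw dw (nb-adj Ny)
      p₁ p₂ : Subset n
      p₁ = swap b w p
      p₂ = swap y v p₁
      p₁y : lookup p₁ y ≡ t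
      p₁y = trans (swap-miss p y≢b (W≢B py pw)) py
      p₁v : lookup p₁ v ≡ not t
      p₁v = trans (swap-miss p (B≢W pv white-b) v≢w) pv
      p₁v′ : lookup p₁ v′ ≡ not t
      p₁v′ = trans (swap-miss p (B≢W pv′ white-b) v′≢w) pv′
      p₂-min : EMin p₂
      -- The first swap made `w` the only white neighbour of `y`. The degrees of `y` and `v` and the
      -- edge between them add up to 3.
      p₂-min = swap-tie (b-tie pw dw) p₁y p₁v (cong₂ _+_
        (d≡1 p₁ refl Ny p₁y (swap-in p white-b pw) p₁v p₁v′)
        (cong₂ _+_ (trans (d-swap-far p (B≢W pv white-b) v≢w (b≁ pv dv ∘ adj-sym) v≁w) dv)
                   (A-adj (nb-adj₂ Ny))))
      z≢y : z ≢ y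
      z≢y = nb-≢ (nb-rotate Nv)
      stay-white : ∀ {x} → White x → x ≢ b → x ≢ y → lookup p₂ x ≡ t
      stay-white px x≢b x≢y = trans (swap-miss p₁ x≢y (W≢B px pv))
        (trans (swap-miss p x≢b (W≢B px pw)) px)
      p₂v′ : lookup p₂ v′ ≡ not t
      p₂v′ = trans (swap-miss p₁ (B≢W pv′ py) (≢-sym (nb-irrefl Nv))) p₁v′
      p₂v : lookup p₂ v ≡ t
      p₂v = swap-in p₁ p₁y p₁v
      p₂z : lookup p₂ z ≡ t
      p₂z = stay-white pz (λ { refl → b≁ pv dv (nb-adj₂ Nz) }) z≢y
      p₂z′ : lookup p₂ z′ ≡ t
      p₂z′ = stay-white pz′ (λ { refl → b≁ pw dw (adj-sym (nb-adj₂ Nw)) }) (nb-≢ (nb-rotate Nw))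
      dz₂ : d p₂ z ≡ 2
      dz₂ = d≡2 p₂ (nb-rotate (nb-rotate Nz)) p₂z p₂v′ p₂z′ p₂v
      dv′₂ : d p₂ v′ ≡ 1
      dv′₂ = d≡1 p₂ not-t (nb-rotate (nb-rotate Nv′)) p₂v′ (swap-out p₁ p₁y p₁v)
        p₂v p₂z

    -- The discharging: every black vertex of degree 1 receives 2 units from its
    -- white neighbours, the ends of a white path with one edge give at most 4 in
    -- total, an end of a longer white path gives at most 2 to each of its two
    -- black neighbours, and b and c give nothing.
    data Kind : Set where
      iso short long inner : Kind

    -- For white vertices, `is-short` describes an end of a white path with a single edge and
    -- `is-long` an end of a longer one.
    data Class (x : Fin n) : Kind → Set where
      is-iso   : d p x ≡ 0 → Class x iso
      is-short : d p x ≡ 1 → Light x → Class x short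
      is-long  : d p x ≡ 1 → ¬ Light x → Class x long
      is-inner : 2 ≤ d p x → Class x inner

    abstract

      light? : ∀ x → Dec (Light x)
      light? x with any? (λ k → adj? x k ×-dec (lookup p k Bool.≟ t) ×-dec (2 ℕ.≤? d p k))
      ... | yes (k , xk , pk , 2≤dk) = no λ light → ℕ.<⇒≱ 2≤dk (light k xk pk)
      ... | no none = yes λ k xk pk → ℕ.≤-pred (ℕ.≰⇒> λ 2≤dk → none (k , xk , pk , 2≤dk))

      classify : ∀ x → ∃ (Class x)
      classify x with d p x in dx | light? x
      ... | zero        | _         = iso , is-iso dx
      ... | suc zero    | yes light = short , is-short dx light
      ... | suc zero    | no heavy  = long , is-long dx heavy
      ... | suc (suc _) | _         = inner , is-inner (subst (2 ≤_) (sym dx) (s≤s (s≤s z≤n)))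

    kind : Fin n → Kind
    kind x = proj₁ (classify x)

    class : ∀ x → Class x (kind x)
    class x = proj₂ (classify x)

    -- The gift from a white neighbour of kind `i` to a black vertex of degree 1 whose other white
    -- neighbour has kind `j` is `κ i j`. A long end always pays the full 2; a short end supplies
    -- what the other leaves open, and two short ends share.
    κ : Kind → Kind → ℕ
    κ long  _     = 2
    κ short iso   = 2
    κ short short = 1
    κ _     _     = 0

    κ≤2 : ∀ i j → κ i j ≤ 2
    κ≤2 iso   _     = z≤n
    κ≤2 short iso   = ℕ.≤-refl
    κ≤2 short short = s≤s z≤n
    κ≤2 short long  = z≤n
    κ≤2 short inner = z≤n
    κ≤2 long  _     = ℕ.≤-refl
    κ≤2 inner _     = z≤n

    is1 : ℕ → ℕ
    is1 1 = 1
    is1 _ = 0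

    other : Fin n → Fin n → ℕ
    other x o = bit (not (does (o ≟ x)))

    other-self : ∀ x → other x x ≡ 0
    other-self x with x ≟ x
    ... | yes _  = refl
    ... | no x≢x = contradiction refl x≢x

    other-≢ : ∀ {x o} → o ≢ x → other x o ≡ 1
    other-≢ {x} {o} o≢x with o ≟ x
    ... | yes o≡x = contradiction o≡x o≢x
    ... | no _    = refl

    abstract

      -- For a white neighbour `x` of a black `v` of degree 1, the only index that counts is the
      -- other white neighbour of `v`; summing over all `o` selects it without a choice.
      give : Fin n → Fin n → ℕ
      give x v = is1 (d p v) *
        sum (λ o → A v o * (same t (lookup p o) * (other x o * κ (kind x) (kind o))))

      give-nb : ∀ {v m x o} → Nb v m x o → Black m → White o → d p v ≡ 1 →
        give x v ≡ κ (kind x) (kind o)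
      give-nb {v} {m} {x} {o} N pm po dv = begin
        give x v              ≡⟨ cong₂ _*_ (cong is1 dv) (∑nb N _) ⟩
        1 * (same t (lookup p m) * (other x m * κ (kind x) (kind m)) +
          (same t (lookup p x) * (other x x * κ (kind x) (kind x)) +
           same t (lookup p o) * (other x o * κ (kind x) (kind o))))
          ≡⟨ ℕ.*-identityˡ _ ⟩
        same t (lookup p m) * (other x m * κ (kind x) (kind m)) +
          (same t (lookup p x) * (other x x * κ (kind x) (kind x)) +
           same t (lookup p o) * (other x o * κ (kind x) (kind o)))
          ≡⟨ cong₂ (λ i j → i * (other x m * κ (kind x) (kind m)) +
               (same t (lookup p x) * (j * κ (kind x) (kind x)) +
                same t (lookup p o) * (other x o * κ (kind x) (kind o))))
               (same-opp pm) (other-self x) ⟩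
        same t (lookup p x) * 0 + same t (lookup p o) * (other x o * κ (kind x) (kind o))
          ≡⟨ cong₂ _+_ (ℕ.*-zeroʳ (same t (lookup p x)))
               (cong₂ (λ i j → i * (j * κ (kind x) (kind o))) (same-refl po)
                 (other-≢ (≢-sym (nb-≢ (nb-rotate N))))) ⟩
        1 * (1 * κ (kind x) (kind o))
          ≡⟨ trans (ℕ.*-identityˡ _) (ℕ.*-identityˡ _) ⟩
        κ (kind x) (kind o)   ∎
        where open ≡-Reasoning

      give-nothing : ∀ {x v} → (∀ k → κ (kind x) k ≡ 0) → give x v ≡ 0
      give-nothing {x} {v} none = trans (cong (is1 (d p v) *_) (∑-zero {n} λ o →
        trans (cong (λ k → A v o * (same t (lookup p o) * (other x o * k))) (none (kind o)))
          (trans (cong (λ k → A v o * (same t (lookup p o) * k)) (ℕ.*-zeroʳ (other x o)))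
            (trans (cong (A v o *_) (ℕ.*-zeroʳ (same t (lookup p o)))) (ℕ.*-zeroʳ (A v o))))))
        (ℕ.*-zeroʳ (is1 (d p v)))

      give-unless1 : ∀ {x v} → d p v ≢ 1 → give x v ≡ 0
      give-unless1 {x} {v} dv≢1 = cong (_* sum (λ o → A v o * (same t (lookup p o) * (other x o * κ (kind x) (kind o)))))
        (is1-≢ (d p v) dv≢1)
        where
        is1-≢ : ∀ k → k ≢ 1 → is1 k ≡ 0
        is1-≢ zero          _   = refl
        is1-≢ (suc zero)    1≢1 = contradiction refl 1≢1
        is1-≢ (suc (suc k)) _   = refl

    -- Gifts from the ends of a single white edge

    iso⇒light : ∀ {x} → White x → d p x ≡ 0 → Light x
    iso⇒light px dx k xk pk = contradiction (isolated {p} px dx xk) (not≢ pk)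

    Gift : Fin n → Fin n → Set
    Gift z v = d p v ≡ 1 × ∃ λ m → ∃ λ o → Nb v m z o × Black m × White o × give z v ≡ κ (kind z) (kind o)

    gift : ∀ {z v} → White z → Black v → Adj z v → give z v ≡ 0 ⊎ Gift z v
    gift {z} {v} pz pv zv with d p v ℕ.≟ 1
    ... | no dv≢1 = inj₁ (give-unless1 dv≢1)
    ... | yes dv with m , o , N , pm , po ← black-pendant pv dv pz (adj-sym zv) =
      inj₂ (dv , m , o , N , pm , po , give-nb N pm po dv)

    give≤2 : ∀ {z v} → White z → Black v → Adj z v → give z v ≤ 2
    give≤2 {z} pz pv zv with gift pz pv zv
    ... | inj₁ g≡0 = subst (_≤ 2) (sym g≡0) z≤n
    ... | inj₂ (_ , _ , o , _ , _ , _ , g≡κ) = subst (_≤ 2) (sym g≡κ) (κ≤2 (kind z) (kind o))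

    record Receiver (z v : Fin n) : Set where
      field
        {m o}   : Fin n
        d≡      : d p v ≡ 1
        N       : Nb v m z o
        pm      : Black m
        po      : White o
        light   : Light o
        isolate : give z v ≡ 2 → d p o ≡ 0
        amount  : give z v ≡ κ short (kind o)

    -- As `κ short` vanishes on `long` and `inner`, a nonzero gift means that the other white
    -- neighbour is isolated or short, hence light; the amount 2 leaves only the isolated case.
    receiver : ∀ {z v} → White z → kind z ≡ short → Black v → Adj z v → give z v ≢ 0 → Receiver z v
    receiver {z} {v} pz kz pv zv g≢0 with gift pz pv zv
    ... | inj₁ g≡0 = contradiction g≡0 g≢0
    ... | inj₂ (dv , m , o , N , pm , po , g≡κ) = record
      { d≡ = dv ; N = N ; pm = pm ; po = po
      ; light = proj₁ (light (kind o) (class o) (g≢0 ∘ trans g≡))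
      ; isolate = λ g≡2 → proj₂ (light (kind o) (class o) (g≢0 ∘ trans g≡)) (trans (sym g≡) g≡2)
      ; amount = g≡
      }
      where
      g≡ : give z v ≡ κ short (kind o)
      g≡ = trans g≡κ (cong (λ k → κ k (kind o)) kz)
      light : ∀ k → Class o k → κ short k ≢ 0 → Light o × (κ short k ≡ 2 → d p o ≡ 0)
      light iso   (is-iso do≡0)    _   = iso⇒light po do≡0 , λ _ → do≡0
      light short (is-short _ lo)  _   = lo , λ ()
      light long  _                κ≢0 = contradiction refl κ≢0
      light inner _                κ≢0 = contradiction refl κ≢0

    mate : ∀ {v m z y v′} → Nb v m z y → White z → White y → Adj v v′ → Black v′ → m ≡ v′
    mate N pz py vv′ pv′ with nb-cover N vv′
    ... | inj₁ v′≡m        = sym v′≡m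
    ... | inj₂ (inj₁ refl) = contradiction refl (B≢W pv′ pz)
    ... | inj₂ (inj₂ refl) = contradiction refl (B≢W pv′ py)

    mates : ∀ {z z′ v v′} → Nb z z′ v v′ → White z → White z′ → Black v → Black v′ →
      d p v ≡ 1 → d p v′ ≡ 1 → Adj v v′
    mates {v = v} {v′} Nz pz pz′ pv pv′ dv dv′ =
      decidable-stable (adj? v v′) (black-mates Nz pz pz′ pv pv′ dv dv′)

    -- If `s` is not `y`, `exchange` applies to `v` and `w`. If `s` is `y` but `y′` is not, it
    -- applies to the mirror image, with `w` as the new centre and `v′` traded against `z`. If all
    -- three coincide, `no-diamond` applies.
    no-third-receiver : ∀ {z z′ v v′ y y′ w q w′ s} →
      Nb z z′ v v′ → White z → White z′ →
      Nb v v′ z y → Black v → White y → d p y ≡ 0 →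
      Nb v′ v z y′ → Black v′ → White y′ → Light y′ →
      Nb z′ z w q → Black w → Black q →
      Nb w w′ z′ s → Black w′ → White s → Light s →
      ¬ Adj z′ v′ → ⊥
    no-third-receiver {z} {z′} {v} {v′} {y} {y′} {w} {q} {w′} {s}
      Nz pz pz′ Nv pv py dy Nv′ pv′ py′ light-y′ Nz′ pw pq Nw pw′ ps light-s z′≁v′ =
      split (s ≟ y) (y′ ≟ y)
      where
      v′≢w : v′ ≢ w
      v′≢w refl = z′≁v′ (nb-adj₂ Nz′)
      v′≢q : q ≢ v′
      v′≢q refl = z′≁v′ (nb-adj₃ Nz′)
      v≢w : v ≢ w
      v≢w refl with nb-cover Nv (adj-sym (nb-adj₂ Nz′))
      ... | inj₁ refl        = B≢W pv′ pz′ refl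
      ... | inj₂ (inj₁ refl) = nb-irrefl Nz refl
      ... | inj₂ (inj₂ refl) = not≢ pz (isolated {p} py dy (nb-adj Nz′))
      w′≢v′ : w′ ≢ v′
      w′≢v′ refl with nb-cover Nv′ (adj-sym (nb-adj Nw))
      ... | inj₁ refl        = v≢w refl
      ... | inj₂ (inj₁ refl) = B≢W pw pz refl
      ... | inj₂ (inj₂ refl) = B≢W pw py′ refl
      split : Dec (s ≡ y) → Dec (y′ ≡ y) → ⊥
      split (no s≢y) _ =
        exchange (nb-swap Nv) pv pv′ py dy Nz pz pz′ pv′ Nz′ pw pq Nw pw′ ps light-s
          v≢w v′≢w v′≢w s≢y
      split (yes refl) (yes refl) =
        no-diamond Nv Nv′ pv pv′ py pz Nz pz′ Nw pw pw′ v≢w v′≢w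
      split (yes refl) (no y′≢y) =
        exchange (nb-swap Nw) pw pw′ py dy Nz′ pz′ pz pq (nb-swap Nz) pv′ pv Nv′ pv py′ light-y′
          (≢-sym v′≢w) v′≢q w′≢v′ y′≢y

    -- The receivers `v` and `v′` of `z` are adjacent by `mates`. If `v′` is not adjacent to `z′`,
    -- then `z′` gives nothing by `no-third-receiver`, and `z` alone gives at most 4. Otherwise `v′`
    -- gets 1 from each end, and with the 2 for `v` the total is exactly 4.
    capped : ∀ {z z′ v v′ w q} → Nb z z′ v v′ → White z → kind z ≡ short → Black v → Black v′ →
      Nb z′ z w q → White z′ → kind z′ ≡ short → Black w → Black q →
      give z v ≡ 2 → give z v′ ≢ 0 → give z v + give z v′ + (give z′ w + give z′ q) ≤ 4
    capped {z} {z′} {v} {v′} {w} {q} Nz pz kz pv pv′ Nz′ pz′ kz′ pw pq give≡2 give≢0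
      with receiver pz kz pv (nb-adj₂ Nz) (λ g≡0 → contradiction (trans (sym g≡0) give≡2) λ ())
         | receiver pz kz pv′ (nb-adj₃ Nz) give≢0
    ... | record { o = y ; d≡ = dv ; N = Nv ; po = py ; isolate = isolate }
        | record { o = y′ ; d≡ = dv′ ; N = Nv′ ; po = py′ ; light = light-y′ ; amount = amount′ }
      with vv′ ← mates Nz pz pz′ pv pv′ dv dv′
      with refl ← mate Nv pz py vv′ pv′
         | refl ← mate Nv′ pz py′ (adj-sym vv′) pv
      = cap (adj? z′ v′)
      where
      dy : d p y ≡ 0
      dy = isolate give≡2
      v≁z′ : ¬ Adj v z′
      v≁z′ vz′ with nb-cover Nv vz′
      ... | inj₁ refl        = B≢W pv′ pz′ refl
      ... | inj₂ (inj₁ refl) = nb-irrefl Nz refl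
      ... | inj₂ (inj₂ refl) = not≢ pz (isolated {p} py dy (nb-adj Nz′))
      silent : ∀ {x r} → Nb z′ z x r → Black x → Black r → ¬ Adj z′ v′ → give z′ x ≡ 0
      silent {x} N px pr z′≁v′ with give z′ x ℕ.≟ 0
      ... | yes g≡0 = g≡0
      ... | no g≢0 with record { N = Nx ; pm = pm ; po = po ; light = light } ← receiver pz′ kz′ px (nb-adj₂ N) g≢0 =
        ⊥-elim (no-third-receiver Nz pz pz′ Nv pv py dy Nv′ pv′ py′ light-y′ N px pr Nx pm po light z′≁v′)
      -- Here y′ = z′, so v′ is a common neighbour of z and z′.
      shared : ∀ {r} → Nb z′ z v′ r → Black r → give z v′ ≡ 1 × give z′ v′ ≡ 1 × give z′ r ≡ 0
      shared {r} N pr with nb-cover Nv′ (adj-sym (nb-adj₂ N))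
      ... | inj₁ refl        = contradiction refl (B≢W pv pz′)
      ... | inj₂ (inj₁ refl) = contradiction refl (nb-irrefl Nz)
      ... | inj₂ (inj₂ refl) =
        trans amount′ (cong (κ short) kz′) ,
        trans (give-nb (nb-swap Nv′) pv pz dv′) (cong₂ κ kz′ kz) ,
        rest
        where
        rest : give z′ r ≡ 0
        rest with give z′ r ℕ.≟ 0
        ... | yes g≡0 = g≡0
        -- If `r` received something, `mates` would make it a neighbour of `v′`, but the neighbours
        -- of `v′` are `v`, `z` and `z′`, and none of them can be `r`.
        ... | no g≢0 with nb-cover Nv′ (mates N pz′ pz pv′ pr dv′ (Receiver.d≡ (receiver pz′ kz′ pr (nb-adj₃ N) g≢0)))
        ...   | inj₁ refl        = contradiction (adj-sym (nb-adj₃ N)) v≁z′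
        ...   | inj₂ (inj₁ refl) = contradiction refl (B≢W pr pz)
        ...   | inj₂ (inj₂ refl) = contradiction refl (B≢W pr pz′)
      cap : Dec (Adj z′ v′) → give z v + give z v′ + (give z′ w + give z′ q) ≤ 4
      cap (no z′≁v′) = ℕ.+-mono-≤
        (ℕ.+-mono-≤ (give≤2 pz pv (nb-adj₂ Nz)) (give≤2 pz pv′ (nb-adj₃ Nz)))
        (ℕ.≤-reflexive (cong₂ _+_ (silent Nz′ pw pq z′≁v′) (silent (nb-swap Nz′) pq pw z′≁v′)))
      cap (yes z′v′) with nb-cover Nz′ z′v′
      ... | inj₁ refl = contradiction refl (B≢W pv′ pz)
      ... | inj₂ (inj₁ refl) with g₁ , g₂ , g₃ ← shared Nz′ pq =
        ℕ.≤-reflexive (cong₂ _+_ (cong₂ _+_ give≡2 g₁) (cong₂ _+_ g₂ g₃))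
      ... | inj₂ (inj₂ refl) with g₁ , g₂ , g₃ ← shared (nb-swap Nz′) pw =
        ℕ.≤-reflexive (cong₂ _+_ (cong₂ _+_ give≡2 g₁) (cong₂ _+_ g₃ g₂))

    -- Totals given by white vertices and edges

    total : Fin n → ℕ
    total x = sum (λ v → A x v * (same (not t) (lookup p v) * give x v))

    total-nb : ∀ {x y e f} → Nb x y e f → White y → Black e → Black f → total x ≡ give x e + give x f
    total-nb {x} {y} {e} {f} N py pe pf = trans (∑nb N _)
      (cong₂ _+_ (cong (_* give x y) (same-opp (trans py (sym (not-involutive t)))))
        (cong₂ _+_ (trans (cong (_* give x e) (same-refl pe)) (ℕ.*-identityˡ _))
                   (trans (cong (_* give x f) (same-refl pf)) (ℕ.*-identityˡ _))))

    total-nothing : ∀ {x} → (∀ k → κ (kind x) k ≡ 0) → total x ≡ 0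
    total-nothing {x} none = ∑-zero {n} λ v →
      trans (cong (λ k → A x v * (same (not t) (lookup p v) * k)) (give-nothing none))
        (trans (cong (A x v *_) (ℕ.*-zeroʳ (same (not t) (lookup p v)))) (ℕ.*-zeroʳ (A x v)))

    total-pendant : ∀ {x} → White x → d p x ≡ 1 → total x ≤ 4
    total-pendant px dx with y , e , f , N , py , pe , pf ← pendant {p} refl px dx =
      subst (_≤ 4) (sym (total-nb N py pe pf))
        (ℕ.+-mono-≤ (give≤2 px pe (nb-adj₂ N)) (give≤2 px pf (nb-adj₃ N)))

    -- Singles out the gifts of one end that call for `capped`; when both ends stay within 2, the
    -- bound 4 is immediate.
    small-sum : ∀ {i j} → i ≤ 2 → j ≤ 2 → i + j ≤ 2 ⊎ (i ≡ 2 × j ≢ 0) ⊎ (j ≡ 2 × i ≢ 0)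
    small-sum {zero}              _ j≤2 = inj₁ j≤2
    small-sum {suc zero} {zero}   _ _ = inj₁ (s≤s z≤n)
    small-sum {suc zero} {suc zero} _ _ = inj₁ ℕ.≤-refl
    small-sum {suc zero} {suc (suc zero)} _ _ = inj₂ (inj₂ (refl , λ ()))
    small-sum {suc (suc zero)} {zero} _ _ = inj₁ ℕ.≤-refl
    small-sum {suc (suc zero)} {suc j} _ _ = inj₂ (inj₁ (refl , λ ()))
    small-sum {suc zero} {suc (suc (suc _))} _ (s≤s (s≤s ()))
    small-sum {suc (suc (suc _))} (s≤s (s≤s ()))

    short-edge : ∀ {z z′ v v′ w q} → Nb z z′ v v′ → White z → kind z ≡ short → Black v → Black v′ →
      Nb z′ z w q → White z′ → kind z′ ≡ short → Black w → Black q →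
      give z v + give z v′ + (give z′ w + give z′ q) ≤ 4
    short-edge {z} {z′} {v} {v′} {w} {q} Nz pz kz pv pv′ Nz′ pz′ kz′ pw pq
      with small-sum (give≤2 pz pv (nb-adj₂ Nz)) (give≤2 pz pv′ (nb-adj₃ Nz))
         | small-sum (give≤2 pz′ pw (nb-adj₂ Nz′)) (give≤2 pz′ pq (nb-adj₃ Nz′))
    ... | inj₁ ≤2 | inj₁ ≤2′ = ℕ.+-mono-≤ ≤2 ≤2′
    ... | inj₂ (inj₁ (≡2 , ≢0)) | _ = capped Nz pz kz pv pv′ Nz′ pz′ kz′ pw pq ≡2 ≢0
    ... | inj₂ (inj₂ (≡2 , ≢0)) | _ =
      subst (λ i → i + (give z′ w + give z′ q) ≤ 4) (ℕ.+-comm (give z v′) _)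
        (capped (nb-swap Nz) pz kz pv′ pv Nz′ pz′ kz′ pw pq ≡2 ≢0)
    ... | inj₁ _ | inj₂ (inj₁ (≡2 , ≢0)) =
      subst (_≤ 4) (ℕ.+-comm (give z′ w + give z′ q) _)
        (capped Nz′ pz′ kz′ pw pq Nz pz kz pv pv′ ≡2 ≢0)
    ... | inj₁ _ | inj₂ (inj₂ (≡2 , ≢0)) =
      subst (_≤ 4) (trans (cong (_+ (give z v + give z v′)) (ℕ.+-comm (give z′ q) _)) (ℕ.+-comm (give z′ w + give z′ q) _))
        (capped (nb-swap Nz′) pz′ kz′ pq pw Nz pz kz pv pv′ ≡2 ≢0)

    unpaid : ∀ {x} → d p x ≢ 1 → total x ≡ 0
    unpaid {x} dx≢1 = total-nothing (none (class x))
      where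
      none : ∀ {k} → Class x k → ∀ k′ → κ k k′ ≡ 0
      none (is-iso _)     _ = refl
      none (is-short dx _)  = contradiction dx dx≢1
      none (is-long dx _)   = contradiction dx dx≢1
      none (is-inner _)   _ = refl

    total≤4 : ∀ {x} → White x → total x ≤ 4
    total≤4 {x} px with d p x ℕ.≟ 1
    ... | yes dx  = total-pendant px dx
    ... | no dx≢1 = subst (_≤ 4) (sym (unpaid dx≢1)) z≤n

    only-neighbour : ∀ {x y} → White x → White y → Adj x y → d p x ≡ 1 →
      ∃ λ e → ∃ λ f → Nb x y e f × Black e × Black f
    only-neighbour px py xy dx
      with _ , e , f , N , _ , pe , pf ← pendant {p} refl px dx with nb-cover N xy
    ... | inj₁ refl        = e , f , N , pe , pf
    ... | inj₂ (inj₁ refl) = contradiction refl (W≢B py pe)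
    ... | inj₂ (inj₂ refl) = contradiction refl (W≢B py pf)

    short-kind : ∀ {x y} → White x → White y → Adj x y → d p x ≡ 1 → d p y ≡ 1 → kind x ≡ short
    short-kind {x} {y} px py xy dx dy = go (class x)
      where
      go : ∀ {k} → Class x k → k ≡ short
      go (is-iso dx≡0)   = contradiction (trans (sym dx) dx≡0) λ ()
      go (is-short _ _)  = refl
      go (is-inner 2≤dx) = contradiction (subst (2 ≤_) dx 2≤dx) λ { (s≤s ()) }
      go (is-long _ ¬light) = contradiction light ¬light
        where
        light : Light x
        light k xk pk with e , f , N , pe , pf ← only-neighbour px py xy dx with nb-cover N xk
        ... | inj₁ refl        = ℕ.≤-reflexive dy
        ... | inj₂ (inj₁ refl) = contradiction refl (W≢B pk pe)
        ... | inj₂ (inj₂ refl) = contradiction refl (W≢B pk pf)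

    -- An end whose degree is not 1 gives nothing, and the other end gives at most 4 by itself. If
    -- both degrees are 1, both ends are short and `short-edge` applies.
    edge≤4 : ∀ {x y} → White x → White y → Adj x y → total x + total y ≤ 4
    edge≤4 {x} {y} px py xy with d p x ℕ.≟ 1 | d p y ℕ.≟ 1
    ... | no dx≢1 | _       = subst (λ k → k + total y ≤ 4) (sym (unpaid dx≢1)) (total≤4 py)
    ... | yes _   | no dy≢1 = subst (λ k → total x + k ≤ 4) (sym (unpaid dy≢1))
                                (subst (_≤ 4) (sym (ℕ.+-identityʳ (total x))) (total≤4 px))
    ... | yes dx  | yes dy
      with _ , _ , N , pe , pf ← only-neighbour px py xy dx
         | _ , _ , M , pg , ph ← only-neighbour py px (adj-sym xy) dy =
      subst₂ (λ i j → i + j ≤ 4) (sym (total-nb N py pe pf)) (sym (total-nb M px pg ph))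
        (short-edge N px (short-kind px py xy dx dy) pe pf
                    M py (short-kind py px (adj-sym xy) dy dx) pg ph)

    -- Double counting of the gifts

    receipts : Fin n → ℕ
    receipts v = sum (λ x → A v x * (same t (lookup p x) * give x v))

    -- By `heavy≁` no white neighbour of `v` is inner, and `not-both-isolated` excludes two isolated
    -- ones. In all remaining rows of `κ` the two gifts add up to at least 2.
    receipts≥2 : ∀ {v} → Black v → d p v ≡ 1 → 2 ≤ receipts v
    receipts≥2 {v} pv dv
      with m , y , z , N , pm , py , pz ← pendant {p} (sym (not-involutive t)) pv dv =
      ℕ.≤-trans (enough (class y) (class z)) (ℕ.≤-reflexive (sym (begin
        receipts v
          ≡⟨ ∑nb N _ ⟩
        same t (lookup p m) * give m v + (same t (lookup p y) * give y v + same t (lookup p z) * give z v)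
          ≡⟨ cong₂ _+_ (cong (_* give m v) (same-opp pm))
               (cong₂ _+_ (trans (cong (_* give y v) (same-refl py)) (ℕ.*-identityˡ _))
                          (trans (cong (_* give z v) (same-refl pz)) (ℕ.*-identityˡ _))) ⟩
        give y v + give z v
          ≡⟨ cong₂ _+_ (give-nb N pm pz dv) (give-nb (nb-swap N) pm py dv) ⟩
        κ (kind y) (kind z) + κ (kind z) (kind y) ∎)))
      where
      open ≡-Reasoning
      light : ∀ {x} → White x → Adj v x → ¬ 2 ≤ d p x
      light px vx 2≤dx = heavy≁ px 2≤dx pv dv (adj-sym vx)
      enough : ∀ {i j} → Class y i → Class z j → 2 ≤ κ i j + κ j i
      enough (is-inner 2≤dy) _               = contradiction 2≤dy (light py (nb-adj₂ N))
      enough (is-iso _)      (is-inner 2≤dz) = contradiction 2≤dz (light pz (nb-adj₃ N))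
      enough (is-short _ _)  (is-inner 2≤dz) = contradiction 2≤dz (light pz (nb-adj₃ N))
      enough (is-long _ _)   _               = ℕ.m≤m+n 2 _
      enough (is-iso dy)     (is-iso dz)     = contradiction dz λ dz → not-both-isolated N pv dv pm py pz dy dz
      enough (is-iso _)      (is-short _ _)  = ℕ.≤-refl
      enough (is-iso _)      (is-long _ _)   = ℕ.≤-refl
      enough (is-short _ _)  (is-iso _)      = ℕ.≤-refl
      enough (is-short _ _)  (is-short _ _)  = ℕ.≤-refl
      enough (is-short _ _)  (is-long _ _)   = ℕ.≤-refl

    paid : ℕ
    paid = sum (λ x → same t (lookup p x) * total x)

    -- Black degrees are at most 1, so `mono (not t) p` is the number of black vertices of degree 1,
    -- and each receives at least 2. Exchanging the order of summation turns receipts into payments.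
    demand : 2 * mono (not t) p ≤ paid
    demand = begin
      2 * mono (not t) p
        ≡⟨ ∑-scale 2 (λ v → same (not t) (lookup p v) * d p v) ⟩
      sum (λ v → 2 * (same (not t) (lookup p v) * d p v))
        ≤⟨ ∑-mono-≤ served ⟩
      sum (λ v → same (not t) (lookup p v) * receipts v)
        ≡⟨ ∑-cong (λ v → ∑-scale (same (not t) (lookup p v)) (λ x → A v x * (same t (lookup p x) * give x v))) ⟩
      sum (λ v → sum (λ x → same (not t) (lookup p v) * (A v x * (same t (lookup p x) * give x v))))
        ≡⟨ ∑-comm {n} {n} (λ v x → same (not t) (lookup p v) * (A v x * (same t (lookup p x) * give x v))) ⟩
      sum (λ x → sum (λ v → same (not t) (lookup p v) * (A v x * (same t (lookup p x) * give x v))))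
        ≡⟨ ∑-cong (λ x → ∑-cong λ v → trans
             (cong (λ a → same (not t) (lookup p v) * (a * (same t (lookup p x) * give x v))) (A-sym v x))
             (solve 4 (λ β a ω g → β :* (a :* (ω :* g)) := ω :* (a :* (β :* g))) refl
               (same (not t) (lookup p v)) (A x v) (same t (lookup p x)) (give x v))) ⟩
      sum (λ x → sum (λ v → same t (lookup p x) * (A x v * (same (not t) (lookup p v) * give x v))))
        ≡⟨ ∑-cong (λ x → ∑-scale (same t (lookup p x)) (λ v → A x v * (same (not t) (lookup p v) * give x v))) ⟨
      paid ∎
      where
      open ℕ.≤-Reasoning
      served : ∀ v → 2 * (same (not t) (lookup p v) * d p v) ≤ same (not t) (lookup p v) * receipts v
      served v with either t (lookup p v)
      ... | inj₁ pv = subst (λ s → 2 * (s * d p v) ≤ s * receipts v) (sym (same-opp (trans pv (sym (not-involutive t))))) z≤n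
      ... | inj₂ pv = subst (λ s → 2 * (s * d p v) ≤ s * receipts v) (sym (same-refl pv))
        (subst₂ (λ i j → 2 * i ≤ j) (sym (ℕ.*-identityˡ (d p v))) (sym (ℕ.*-identityˡ (receipts v))) (twice (d p v) refl))
        where
        twice : ∀ k → d p v ≡ k → 2 * k ≤ receipts v
        twice zero          _  = z≤n
        twice (suc zero)    dv = receipts≥2 pv dv
        twice (suc (suc k)) dv = contradiction (subst (_≤ 1) dv (black≤1 v pv)) λ { (s≤s ()) }

    -- The adjacency matrix of the subgraph induced by the white vertices.
    link : Fin n → Fin n → ℕ
    link x y = A x y * (same t (lookup p x) * same t (lookup p y))

    link-sym : ∀ x y → link x y ≡ link y x
    link-sym x y = cong₂ _*_ (A-sym x y) (ℕ.*-comm (same t (lookup p x)) _)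

    ∑link : ∀ x → sum (link x) ≡ same t (lookup p x) * d p x
    ∑link x = trans (∑-cong row) (sym (∑-scale (same t (lookup p x)) (λ y → A x y * same (lookup p x) (lookup p y))))
      where
      row : ∀ y → link x y ≡ same t (lookup p x) * (A x y * same (lookup p x) (lookup p y))
      row y with either t (lookup p x)
      ... | inj₁ px rewrite px = 
        solve 3 (λ a i j → a :* (i :* j) := i :* (a :* j)) refl (A x y) (same t t) (same t (lookup p y))
      ... | inj₂ px rewrite same-opp px = ℕ.*-zeroʳ (A x y)

    -- A white vertex that pays has exactly one white edge, to which its whole payment can be
    -- charged.
    paid≤ : paid ≤ sum (λ x → sum (λ y → link x y * total x))
    paid≤ = ∑-mono-≤ λ x → ℕ.≤-trans (row x) (ℕ.≤-reflexive (begin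
      same t (lookup p x) * d p x * total x ≡⟨ cong (_* total x) (∑link x) ⟨
      sum (link x) * total x                ≡⟨ ℕ.*-comm (sum (link x)) _ ⟩
      total x * sum (link x)                ≡⟨ ∑-scale (total x) (link x) ⟩
      sum (λ y → total x * link x y)        ≡⟨ ∑-cong (λ y → ℕ.*-comm (total x) (link x y)) ⟩
      sum (λ y → link x y * total x)        ∎))
      where
      open ≡-Reasoning
      row : ∀ x → same t (lookup p x) * total x ≤ same t (lookup p x) * d p x * total x
      row x with d p x ℕ.≟ 1
      ... | yes dx  = ℕ.≤-reflexive (cong (_* total x) (sym (trans (cong (same t (lookup p x) *_) dx) (ℕ.*-identityʳ (same t (lookup p x))))))
      ... | no dx≢1 rewrite unpaid dx≢1 | ℕ.*-zeroʳ (same t (lookup p x)) = z≤n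

    -- Charging each payment from both sides of the matrix `link` puts `total x + total y` on each
    -- ordered white edge, at most 4 by `edge≤4`. The inequality is strict at `(b , c)`, since both
    -- have degree 2 and pay nothing.
    supply : paid + paid < 4 * mono t p
    supply = begin-strict
      paid + paid
        ≤⟨ ℕ.+-mono-≤ paid≤ (ℕ.≤-trans paid≤ (ℕ.≤-reflexive turn)) ⟩
      sum (λ x → sum (λ y → link x y * total x)) + sum (λ x → sum (λ y → link x y * total y))
        ≡⟨ trans (∑-cong (λ x → trans (∑-cong λ y → ℕ.*-distribˡ-+ (link x y) (total x) (total y)) (∑-+ (λ y → link x y * total x) (λ y → link x y * total y))))
                 (∑-+ (λ x → sum (λ y → link x y * total x)) (λ x → sum (λ y → link x y * total y))) ⟨
      sum (λ x → sum (λ y → link x y * (total x + total y)))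
        <⟨ ∑-mono-< (λ x → ∑-mono-≤ (entry x)) b (∑-mono-< (entry b) c gap) ⟩
      sum (λ x → sum (λ y → 4 * link x y))
        ≡⟨ ∑-cong (λ x → trans (sym (∑-scale 4 (link x))) (cong (4 *_) (∑link x))) ⟩
      sum (λ x → 4 * (same t (lookup p x) * d p x))
        ≡⟨ ∑-scale 4 (λ x → same t (lookup p x) * d p x) ⟨
      4 * mono t p ∎
      where
      open ℕ.≤-Reasoning
      turn : sum (λ x → sum (λ y → link x y * total x)) ≡ sum (λ x → sum (λ y → link x y * total y))
      turn = trans (∑-comm {n} {n} (λ x y → link x y * total x))
        (∑-cong λ y → ∑-cong λ x → cong (_* total x) (link-sym x y))
      entry : ∀ x y → link x y * (total x + total y) ≤ 4 * link x y
      entry x y with adj? x y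
      ... | no _ = z≤n
      ... | yes xy with either t (lookup p x) | either t (lookup p y)
      ... | inj₂ px | _       rewrite same-opp px = z≤n
      ... | inj₁ px | inj₂ py rewrite same-opp py | ℕ.*-zeroʳ (same t (lookup p x)) = z≤n
      ... | inj₁ px | inj₁ py rewrite same-refl px | same-refl py | ℕ.+-identityʳ (total x + total y) = edge≤4 px py xy
      gap : link b c * (total b + total c) < 4 * link b c
      gap rewrite A-adj b∼c | same-refl {t = t} white-b | same-refl white-c
        | unpaid {b} (λ db → contradiction (trans (sym d-b) db) λ ())
        | unpaid {c} (λ dc → contradiction (trans (sym d-c) dc) λ ()) = s≤s z≤n

    impossible : ⊥
    impossible = ℕ.<⇒≱ supply (begin
      4 * mono t p                            ≡⟨ cong (4 *_) (mono-balanced t {p} (EMin.balanced p-min)) ⟩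
      4 * mono (not t) p                      ≡⟨ ℕ.*-distribʳ-+ (mono (not t) p) 2 2 ⟩
      2 * mono (not t) p + 2 * mono (not t) p ≤⟨ ℕ.+-mono-≤ demand demand ⟩
      paid + paid                             ∎)
      where open ℕ.≤-Reasoning

  -- From colour classes to components

  module Components (p : Subset n) (min : Min p) where

    no-bad-pair : ∀ {x y} → ¬ BadPair p x y
    no-bad-pair {x} {y} bad = BadPairMoves.impossible p min x y bad

    two-neighbours : ∀ {s x y z} → lookup p x ≡ s → lookup p y ≡ s → lookup p z ≡ s →
      Adj x y → Adj x z → y ≢ z → 2 ≤ d p x
    two-neighbours {s} {x} {y} {z} px py pz xy xz y≢z with e , f , N ← focus xy with nb-cover N xz
    ... | inj₁ refl        = contradiction refl y≢z
    ... | inj₂ (inj₁ refl) = 2≤d p N px py pz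
    ... | inj₂ (inj₂ refl) = 2≤d p (nb-swap N) px py pz

    Calm : Fin n → Set
    Calm x = ∀ k → Adj x k → lookup p x ≡ lookup p k → d p k ≤ 1

    -- If `r` has a neighbour of its colour with degree at least 2, that neighbour is calm, for
    -- otherwise there would be a bad pair; if it has none, `r` itself is calm.
    calm-centre : ∀ r → ∃ λ m → (m ≡ r ⊎ Adj m r × lookup p m ≡ lookup p r) × Calm m
    calm-centre r with any? (λ a → adj? r a ×-dec (lookup p r Bool.≟ lookup p a) ×-dec (2 ℕ.≤? d p a))
    ... | no none = r , inj₁ refl , λ k rk r≡k → ℕ.≤-pred (ℕ.≰⇒> λ 2≤dk → none (k , rk , r≡k , 2≤dk))
    ... | yes (a , ra , r≡a , 2≤da) = a , inj₂ (adj-sym ra , sym r≡a) ,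
      λ k ak a≡k → ℕ.≤-pred (ℕ.≰⇒> λ 2≤dk → no-bad-pair (ak , a≡k , 2≤da , 2≤dk))

    -- By `d≤2` some neighbour has the other colour, and rotation moves it to the last place.
    neighbours≤2 : ∀ x → ∃ λ a → ∃ λ e → ∃ λ f → Nb x a e f × lookup p f ≡ not (lookup p x)
    neighbours≤2 x with a , e , f , N ← neighbourhood x
      with either (lookup p x) (lookup p a) | either (lookup p x) (lookup p e) | either (lookup p x) (lookup p f)
    ... | _       | _       | inj₂ pf = a , e , f , N , pf
    ... | _       | inj₂ pe | inj₁ _  = f , a , e , nb-rotate (nb-rotate N) , pe
    ... | inj₂ pa | inj₁ _  | inj₁ _  = e , f , a , nb-rotate N , pa
    ... | inj₁ pa | inj₁ pe | inj₁ pf = contradiction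
      (subst (_≤ 2) (d-eval p N refl pa pe pf) (d≤2 (Min.energy-min min) x))
      (subst (λ i → ¬ i + (i + i) ≤ 2) (sym (same-refl {t = lookup p x} refl)) λ { (s≤s (s≤s ())) })

    module _ (S : Subset n) (s : Bool) (colour : ∀ {x} → x ∈ S → lookup p x ≡ s) where

      -- Every vertex of a cycle has two neighbours of its own colour on it, so `v₁` and `v₂` form a
      -- bad pair. The triangle is treated apart because there the successor of `v₂` is `v₀`.
      acyclic : ∀ {C} → C ⊆ S → ¬ Cycle G C
      acyclic C⊆S record { start = v₀ ; rest = v₁ ∷ [] ; long = s≤s (s≤s ()) }
      acyclic C⊆S record { start = v₀ ; rest = v₁ ∷ v₂ ∷ []
                         ; distinct = (v₀≢v₁ ∷ v₀≢v₂ ∷ _) ∷ _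
                         ; closed = (c₀ , c₁ , e₀₁) ∷ (_ , c₂ , e₁₂) ∷ (_ , _ , e₂₀) ∷ _ } =
        no-bad-pair (e₁₂ , trans p₁ (sym p₂) ,
          two-neighbours p₁ p₀ p₂ (adj-sym e₀₁) e₁₂ v₀≢v₂ ,
          two-neighbours p₂ p₁ p₀ (adj-sym e₁₂) e₂₀ (≢-sym v₀≢v₁))
        where
        p₀ = colour (C⊆S c₀)
        p₁ = colour (C⊆S c₁)
        p₂ = colour (C⊆S c₂)
      acyclic C⊆S record { start = v₀ ; rest = v₁ ∷ v₂ ∷ v₃ ∷ _
                         ; distinct = (_ ∷ v₀≢v₂ ∷ _) ∷ (_ ∷ v₁≢v₃ ∷ _) ∷ _
                         ; closed = (c₀ , c₁ , e₀₁) ∷ (_ , c₂ , e₁₂) ∷ (_ , c₃ , e₂₃) ∷ _ } =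
        no-bad-pair (e₁₂ , trans p₁ (sym p₂) ,
          two-neighbours p₁ p₀ p₂ (adj-sym e₀₁) e₁₂ v₀≢v₂ ,
          two-neighbours p₂ p₁ p₃ (adj-sym e₁₂) e₂₃ v₁≢v₃)
        where
        p₀ = colour (C⊆S c₀)
        p₁ = colour (C⊆S c₁)
        p₂ = colour (C⊆S c₂)
        p₃ = colour (C⊆S c₃)

      -- All of `C` lies within distance 1 of a calm centre `m`, and at most two neighbours of `m`
      -- have the right colour.
      connected-≤3 : ∀ {C} → C ⊆ S → Connected G C → ∣ C ∣ ≤ 3
      connected-≤3 {C} C⊆S record { nonempty = r , r∈C ; walk = walk }
        with m , m∼r , calm ← calm-centre r
        with a , e , f , N , pf ← neighbours≤2 m = begin
        ∣ C ∣                             ≤⟨ p⊆q⇒∣p∣≤∣q∣ C⊆ball ⟩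
        ∣ ⁅ m ⁆ ∪ (⁅ a ⁆ ∪ ⁅ e ⁆) ∣       ≤⟨ ∣p∪q∣≤∣p∣+∣q∣ ⁅ m ⁆ _ ⟩
        ∣ ⁅ m ⁆ ∣ + ∣ ⁅ a ⁆ ∪ ⁅ e ⁆ ∣     ≤⟨ ℕ.+-monoʳ-≤ ∣ ⁅ m ⁆ ∣ (∣p∪q∣≤∣p∣+∣q∣ ⁅ a ⁆ ⁅ e ⁆) ⟩
        ∣ ⁅ m ⁆ ∣ + (∣ ⁅ a ⁆ ∣ + ∣ ⁅ e ⁆ ∣) ≡⟨ cong₂ _+_ (∣⁅x⁆∣≡1 m) (cong₂ _+_ (∣⁅x⁆∣≡1 a) (∣⁅x⁆∣≡1 e)) ⟩
        3                                 ∎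
        where
        open ℕ.≤-Reasoning
        Ball : Fin n → Set
        Ball x = x ≡ m ⊎ Adj m x
        pm : lookup p m ≡ s
        pm = trans ([ cong (lookup p) , proj₂ ]′ m∼r) (colour (C⊆S r∈C))
        step : ∀ {x y} → InducedAdj G C x y → Ball x → Ball y
        step (_ , _ , xy) (inj₁ refl) = inj₂ xy
        -- A step from a neighbour `x` of `m` must return to `m`: another target would give `x`
        -- degree 2, although `m` is calm.
        step {x} {y} (x∈C , y∈C , xy) (inj₂ mx) with y ≟ m
        ... | yes y≡m = inj₁ y≡m
        ... | no y≢m  = contradiction
          (ℕ.≤-trans (two-neighbours (colour (C⊆S x∈C)) (colour (C⊆S y∈C)) pm xy (adj-sym mx) y≢m)
                     (calm x mx (trans pm (sym (colour (C⊆S x∈C))))))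
          λ { (s≤s ()) }
        along : ∀ {x y} → Star (InducedAdj G C) x y → Ball x → Ball y
        along ε        bx = bx
        along (e ◅ es) bx = along es (step e bx)
        ball-r : Ball r
        ball-r = [ inj₁ ∘ sym , inj₂ ∘ proj₁ ]′ m∼r
        C⊆ball : C ⊆ ⁅ m ⁆ ∪ (⁅ a ⁆ ∪ ⁅ e ⁆)
        C⊆ball {x} x∈C with along (walk r∈C x∈C) ball-r
        ... | inj₁ refl = x∈p∪q⁺ (inj₁ (x∈⁅x⁆ x))
        ... | inj₂ mx with nb-cover N mx
        ...   | inj₁ refl        = x∈p∪q⁺ (inj₂ (x∈p∪q⁺ (inj₁ (x∈⁅x⁆ x))))
        ...   | inj₂ (inj₁ refl) = x∈p∪q⁺ (inj₂ (x∈p∪q⁺ (inj₂ (x∈⁅x⁆ x))))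
        -- The ball ignores colours, so the oppositely coloured neighbour `f` has to be excluded
        -- here.
        ...   | inj₂ (inj₂ refl) = contradiction pf (not≢ (trans (colour (C⊆S x∈C)) (sym pm)))

      small : SmallTreeComponents G 3 S
      small C record { within = C⊆S ; connected = connected } =
        record { connected = connected ; acyclic = acyclic C⊆S } , connected-≤3 C⊆S connected

  weak-bisection : ∃ Min → WeakBisection G 5
  weak-bisection (p , min) = p , ∁ p , record
    { bisection = record
      { disjoint = λ { (x , x∈) → let x∈p , x∈∁p = x∈p∩q⁻ p (∁ p) x∈ in x∈p⇒x∉∁p x∈p x∈∁p }
      ; covering = p∪∁p≡⊤ p
      ; balanced = sym (trans (∣∁p∣≡n∸∣p∣ p)
          (trans (cong (_∸ ∣ p ∣) (sym (EMin.balanced (Min.energy-min min)))) (ℕ.m+n∸n≡m ∣ p ∣ ∣ p ∣)))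
      }
    ; small₁ = Components.small p min p true []=⇒lookup
    ; small₂ = Components.small p min (∁ p) false (lookup-∁ p)
    }

theorem11 : ∀ (n : ℕ) (G : Graph n) → Cubic G → WeakBisection G 5
theorem11 n G cubic = CubicGraph.weak-bisection G cubic (CubicGraph.min-exists G cubic)
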